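{- Let $G$ be a finite simple connected graph. Then $\beth^{2}(K^{h(G)})\le \beth^{2}(G)$; that is, $$\binom{h(G)}{3}-\binom{h(G)}{2}+\binom{h(G)}{1}\le \beth^{2}(G).$$
   Context: All graphs are finite and simple. $K^{t}$ is the complete graph on $t$ vertices. The Hadwiger number $h(G)$ is the maximum $t$ such that $K^{t}$ is a minor of $G$. $C(G)$ denotes the set of all induced cycles in $G$ (induced subgraphs of $G$ that are cycles, of length at least 3). The second graph characteristic is $\beth^{2}(G)=|C(G)|-|E(G)|+|V(G)|$. -}

module Defs where

open import Data.Empty using (⊥-elim)
open import Data.Fin using (Fin; toℕ; fromℕ<; _<?_)
open import Data.Fin.Properties using (_≟_; all?; any?; injective⇒≤; toℕ<n; toℕ-fromℕ<)
open import Data.Fin.Subset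
  using (Subset; inside; outside; _∈_; _∉_; _⊃_; _∪_; ⁅_⁆; ⊤; Nonempty)
open import Data.Fin.Subset.Induction using (⊃-wellFounded; Acc; acc)
open import Data.Fin.Subset.Properties
  using (_∈?_; nonempty?; anySubset?; x∈⁅x⁆; x∈⁅y⁆⇒x≡y; p⊆p∪q; q⊆p∪q; x∈p∪q⁻)
open import Data.Integer as ℤ using (ℤ; +_)
open import Data.List as List using (List; length; filter; allFin; cartesianProduct)
open import Data.Nat as ℕ using (ℕ; zero; suc; _≤_; s≤s)
import Data.Nat.DivMod as ℕ
import Data.Nat.Properties as ℕ
open import Data.Product using (∃; ∃₂; _×_; _,_; proj₁; proj₂)
open import Data.Sum using (_⊎_; inj₁; inj₂; [_,_]′)
open import Data.Vec using (Vec; []; _∷_; lookup)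
open import Function using (_⇔_; mk⇔; Equivalence)
open import Function.Definitions using (Injective)
open import Relation.Binary using (Rel; Symmetric; Irreflexive)
  renaming (Decidable to Decidable₂)
open import Relation.Binary.Construct.Closure.ReflexiveTransitive
  using (Star; ε; _◅_; _◅◅_)
open import Relation.Binary.PropositionalEquality
  using (_≡_; _≢_; refl; sym; trans; cong; subst; ≢-sym)
open import Relation.Nullary using (¬_; Dec; yes; no; ¬?; map′; _×-dec_; _⊎-dec_; _→-dec_)
open import Relation.Unary using (Pred; Decidable)
open import Level using (0ℓ)

private
  variable
    k m n : ℕ

_⇔-dec_ : {A B : Set} → Dec A → Dec B → Dec (A ⇔ B)
a? ⇔-dec b? = map′ (λ (f , g) → mk⇔ f g) (λ e → Equivalence.to e , Equivalence.from e)
                   ((a? →-dec b?) ×-dec (b? →-dec a?))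

Searchable : Set → Set₁
Searchable A = {P : Pred A 0ℓ} → Decidable P → Dec (∃ P)

anyVec? : {A : Set} → Searchable A → Searchable (Vec A k)
anyVec? {zero}  search P? = map′ ([] ,_) (λ { ([] , p) → p }) (P? [])
anyVec? {suc k} search P? =
  map′ (λ (x , xs , p) → x ∷ xs , p) (λ { (x ∷ xs , p) → x , xs , p })
       (search λ x → anyVec? search λ xs → P? (x ∷ xs))

injective? : (f : Fin m → Fin n) → Dec (Injective _≡_ _≡_ f)
injective? f = map′ (λ p {x} {y} → p x y) (λ p x y → p {x} {y})
  (all? λ x → all? λ y → (f x ≟ f y) →-dec (x ≟ y))

-- The set T of vertices known to be reachable from x grows until it is closed
-- under R.
star? : {R : Rel (Fin n) 0ℓ} → Decidable₂ R → Decidable₂ (Star R)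
star? {n} {R} R? x y =
  grow ⁅ x ⁆ (⊃-wellFounded _) (x∈⁅x⁆ x)
       (λ z z∈ → subst (Star R x) (sym (x∈⁅y⁆⇒x≡y x z∈)) ε)
  where
  stays : (T : Subset n) → (∀ {u v} → u ∈ T → R u v → v ∈ T) →
          ∀ {u v} → u ∈ T → Star R u v → v ∈ T
  stays T closed u∈T ε        = u∈T
  stays T closed u∈T (r ◅ rs) = stays T closed (closed u∈T r) rs

  grow : (T : Subset n) → Acc _⊃_ T → x ∈ T → (∀ z → z ∈ T → Star R x z) →
         Dec (Star R x y)
  grow T (acc rec) x∈T reach
    with any? (λ u → any? λ v → (u ∈? T) ×-dec ¬? (v ∈? T) ×-dec R? u v)
  ... | yes (u , v , u∈T , v∉T , r) =
        grow (T ∪ ⁅ v ⁆)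
             (rec (p⊆p∪q ⁅ v ⁆ , v , q⊆p∪q T ⁅ v ⁆ (x∈⁅x⁆ v) , v∉T))
             (p⊆p∪q ⁅ v ⁆ x∈T)
             (λ z z∈ → [ reach z
                       , (λ z∈v → subst (Star R x) (sym (x∈⁅y⁆⇒x≡y v z∈v))
                                        (reach u u∈T ◅◅ r ◅ ε))
                       ]′ (x∈p∪q⁻ T ⁅ v ⁆ z∈))
  ... | no ¬leave = map′ (reach y) (stays T closed x∈T) (y ∈? T)
    where
    closed : ∀ {u v} → u ∈ T → R u v → v ∈ T
    closed {u} {v} u∈T r with v ∈? T
    ... | yes v∈T = v∈T
    ... | no  v∉T = ⊥-elim (¬leave (u , v , u∈T , v∉T , r))

IsMaximum : Pred ℕ 0ℓ → ℕ → Set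
IsMaximum P m = P m × (∀ t → P t → t ≤ m)

maximum : {P : Pred ℕ 0ℓ} → Decidable P → P 0 →
          ∀ b → (∀ t → P t → t ≤ b) → ∃ (IsMaximum P)
maximum P? p₀ zero    bound = zero , p₀ , bound
maximum P? p₀ (suc b) bound with P? (suc b)
... | yes p = suc b , p , bound
... | no ¬p = maximum P? p₀ b λ t pt →
      ℕ.≤-pred (ℕ.≤∧≢⇒< (bound t pt) λ { refl → ¬p pt })

record Graph (n : ℕ) : Set₁ where
  field
    Adj    : Rel (Fin n) 0ℓ
    adj?   : Decidable₂ Adj
    symm   : Symmetric Adj
    irrefl : Irreflexive _≡_ Adj

open Graph public

K : ∀ t → Graph t
K t = record
  { Adj    = _≢_
  ; adj?   = λ x y → ¬? (x ≟ y)
  ; symm   = ≢-sym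
  ; irrefl = λ x≡y x≢y → x≢y x≡y
  }

Next : Rel (Fin (suc m)) 0ℓ
Next {m} i j = suc (toℕ i) ℕ.% suc m ≡ toℕ j

next-irrefl : (i : Fin (suc (suc m))) → ¬ Next i i
next-irrefl {m} i eq with ℕ.m≤n⇒m<n∨m≡n (toℕ<n i)
... | inj₁ i+1<k = ℕ.1+n≢n (trans (sym (ℕ.m<n⇒m%n≡m i+1<k)) eq)
... | inj₂ i+1≡k
  with trans (sym (ℕ.suc-injective i+1≡k))
             (trans (sym eq) (trans (cong (ℕ._% suc (suc m)) i+1≡k) (ℕ.n%n≡0 (suc (suc m)))))
...   | ()

-- The length is 3 + m, so that every cycle has at least 3 vertices.
cycle : ∀ m → Graph (3 ℕ.+ m)
cycle m = record
  { Adj    = λ i j → Next i j ⊎ Next j i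
  ; adj?   = λ i j → (_ ℕ.≟ _) ⊎-dec (_ ℕ.≟ _)
  ; symm   = [ inj₂ , inj₁ ]′
  ; irrefl = λ { {i} refl → [ next-irrefl i , next-irrefl i ]′ }
  }

InducedAdj : Graph n → Subset n → Rel (Fin n) 0ℓ
InducedAdj G S x y = x ∈ S × y ∈ S × Adj G x y

-- The subgraph induced by S is connected; in particular S is nonempty.
ConnectedOn : Graph n → Subset n → Set
ConnectedOn G S =
  Nonempty S × (∀ x y → x ∈ S → y ∈ S → Star (InducedAdj G S) x y)

Connected : Graph n → Set
Connected G = ConnectedOn G ⊤

connectedOn? : (G : Graph n) → Decidable (ConnectedOn G)
connectedOn? G S = nonempty? S ×-dec
  (all? λ x → all? λ y → (x ∈? S) →-dec (y ∈? S) →-dec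
    star? (λ u v → (u ∈? S) ×-dec (v ∈? S) ×-dec adj? G u v) x y)

-- B lists the branch sets, one for each vertex of H.
IsModel : Graph k → Graph n → Vec (Subset n) k → Set
IsModel H G B =
  (∀ i → ConnectedOn G (lookup B i)) ×
  (∀ i j → i ≢ j → ∀ x → x ∈ lookup B i → x ∉ lookup B j) ×
  (∀ i j → Adj H i j →
     ∃₂ λ x y → x ∈ lookup B i × y ∈ lookup B j × Adj G x y)

IsMinor : Graph k → Graph n → Set
IsMinor H G = ∃ (IsModel H G)

isMinor? : (H : Graph k) (G : Graph n) → Dec (IsMinor H G)
isMinor? H G = anyVec? anySubset? λ B →
  (all? λ i → connectedOn? G (lookup B i)) ×-dec
  (all? λ i → all? λ j → ¬? (i ≟ j) →-dec
    (all? λ x → (x ∈? lookup B i) →-dec ¬? (x ∈? lookup B j))) ×-dec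
  (all? λ i → all? λ j → adj? H i j →-dec
    (any? λ x → any? λ y →
      (x ∈? lookup B i) ×-dec (y ∈? lookup B j) ×-dec adj? G x y))

isMinor⇒≤ : (H : Graph k) (G : Graph n) → IsMinor H G → k ≤ n
isMinor⇒≤ {k} {n} H G (B , connected , disjoint , _) = injective⇒≤ rep-injective
  where
  rep : Fin k → Fin n
  rep i = proj₁ (proj₁ (connected i))

  rep∈ : ∀ i → rep i ∈ lookup B i
  rep∈ i = proj₂ (proj₁ (connected i))

  rep-injective : Injective _≡_ _≡_ rep
  rep-injective {i} {j} eq with i ≟ j
  ... | yes i≡j = i≡j
  ... | no  i≢j =
        ⊥-elim (disjoint i j i≢j (rep i) (rep∈ i) (subst (_∈ lookup B j) (sym eq) (rep∈ j)))

IsHadwigerNumber : Graph n → ℕ → Set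
IsHadwigerNumber G = IsMaximum (λ t → IsMinor (K t) G)

hadwiger : (G : Graph n) → ∃ (IsHadwigerNumber G)
hadwiger {n} G =
  maximum (λ t → isMinor? (K t) G) ([] , (λ ()) , (λ ()) , (λ ()))
          n (λ t → isMinor⇒≤ (K t) G)

h : Graph n → ℕ
h G = proj₁ (hadwiger G)

-- The vertices vs describe an isomorphism from H onto the subgraph of G
-- induced by S.
IsIsoOnto : Graph k → (G : Graph n) → Subset n → Vec (Fin n) k → Set
IsIsoOnto H G S vs =
  Injective _≡_ _≡_ (lookup vs) ×
  (∀ x → x ∈ S ⇔ ∃ λ i → lookup vs i ≡ x) ×
  (∀ i j → Adj H i j ⇔ Adj G (lookup vs i) (lookup vs j))

isIsoOnto? : (H : Graph k) (G : Graph n) (S : Subset n) → Decidable (IsIsoOnto H G S)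
isIsoOnto? H G S vs =
  injective? (lookup vs) ×-dec
  (all? λ x → (x ∈? S) ⇔-dec any? λ i → lookup vs i ≟ x) ×-dec
  (all? λ i → all? λ j → adj? H i j ⇔-dec adj? G (lookup vs i) (lookup vs j))

InducesCycle : Graph n → Subset n → Set
InducesCycle G S = ∃ λ m → ∃ (IsIsoOnto (cycle m) G S)

inducesCycle? : (G : Graph n) → Decidable (InducesCycle G)
inducesCycle? {n} G S =
  map′ (λ (m , vs , iso) → toℕ m , vs , iso) bounded
       (any? {n} λ m → anyVec? any? (isIsoOnto? (cycle (toℕ m)) G S))
  where
  bounded : InducesCycle G S → ∃ λ (m : Fin n) → ∃ (IsIsoOnto (cycle (toℕ m)) G S)
  bounded (m , vs , iso) =
    fromℕ< m<n ,
    subst (λ l → ∃ (IsIsoOnto (cycle l) G S)) (sym (toℕ-fromℕ< m<n)) (vs , iso)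
    where
    m<n : m ℕ.< n
    m<n = ℕ.≤-trans (s≤s (ℕ.m≤n+m m 2)) (injective⇒≤ (proj₁ iso))

subsets : ∀ n → List (Subset n)
subsets zero    = List.[ [] ]
subsets (suc n) = List.map (outside ∷_) (subsets n) List.++ List.map (inside ∷_) (subsets n)

-- An induced subgraph is represented by its vertex set, which determines it.
inducedCycles : Graph n → List (Subset n)
inducedCycles {n} G = filter (inducesCycle? G) (subsets n)

-- Every edge occurs once, with its smaller endpoint first.
edges : Graph n → List (Fin n × Fin n)
edges {n} G = filter (λ (x , y) → (x <? y) ×-dec adj? G x y)
                     (cartesianProduct (allFin n) (allFin n))

ℶ² : Graph n → ℤ
ℶ² {n} G = + length (inducedCycles G) ℤ.- + length (edges G) ℤ.+ + n

{-# OPTIONS --safe #-}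

-- In a connected graph a K^t minor can be reached by edge contractions alone,
-- so it suffices that contracting an edge uv never increases ℶ². If u and v have
-- c common neighbours, then the contraction loses one vertex and 1 + c edges, so
-- it must be shown to lose at least c induced cycles. The c triangles on uv
-- disappear, and every induced cycle of the contraction lifts to another induced
-- cycle of the graph: if it passes through the merged vertex, replace that vertex
-- by u, by v, or, when neither is adjacent to both of its neighbours on the
-- cycle, by the edge uv, which gives a cycle of length at least 4.

module Submission where

open import Defs
open import Data.Empty using (⊥-elim)
open import Data.Fin as Fin using (Fin; zero; suc; toℕ; fromℕ; fromℕ<)
open import Data.Fin.Properties as Fin
  using (_≟_; any?; all?; toℕ<n; toℕ-fromℕ; toℕ-fromℕ<; toℕ-injective; injective⇒≤; suc-injective)
open import Data.Fin.Subset
  using (Subset; inside; outside; _∈_; _∉_; ⁅_⁆; ⊤; ⊥; ∣_∣) renaming (_-_ to _∖_)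
open import Data.Fin.Subset.Properties
  using (_∈?_; ⊆-antisym; ∈⊤; ∣⊤∣≡n; ∉⊥; p─q⊆p; x∈p∧x≢y⇒x∈p-y; x∈p⇒∣p-x∣<∣p∣)
open import Data.Integer using (+_; _+_; _-_; _≤_)
import Data.Integer as ℤ
import Data.Integer.Properties as ℤ
import Data.Integer.Solver as ℤ
open import Data.List as List using (List; []; _∷_; length; _++_; allFin; filter; cartesianProduct)
open import Data.List.Membership.Propositional as List using ()
open import Data.List.Membership.Propositional.Properties
  using (∈-lookup; ∈-filter⁺; ∈-filter⁻; ∈-allFin; ∈-map⁺; ∈-map⁻; ∈-++⁺ˡ; ∈-++⁺ʳ; ∈-++⁻; ∈-cartesianProduct⁺)
open import Data.List.Properties using (length-map; length-++; length-tabulate)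
open import Data.List.Relation.Unary.All as All using ([]; _∷_)
open import Data.List.Relation.Unary.AllPairs using ([]; _∷_)
open import Data.List.Relation.Unary.Any using (here; there; index)
open import Data.List.Relation.Unary.Any.Properties using (lookup-index)
open import Data.List.Relation.Unary.Unique.Propositional using (Unique)
import Data.List.Relation.Unary.Unique.Propositional.Properties as Unique
open import Data.Nat as ℕ using (ℕ; zero; suc; z≤n; s≤s; _%_)
open import Data.Nat.Combinatorics using (_C_; nC1≡n; nCk+nC[k+1]≡[n+1]C[k+1])
import Data.Nat.DivMod as ℕ
import Data.Nat.Properties as ℕ
import Data.Nat.Solver as ℕ
open import Data.Product using (∃; ∃₂; _×_; _,_; proj₁; proj₂)
open import Data.Sum as Sum using (_⊎_; inj₁; inj₂; [_,_]′)
open import Data.Sum.Properties using (inj₁-injective; inj₂-injective)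
open import Data.Vec as Vec using (Vec; []; _∷_; lookup; tabulate; here; there)
import Data.Vec.Properties as Vec
open import Function using (_∘_; _⇔_; mk⇔; Equivalence)
open import Function.Definitions using (Injective)
open import Level using (0ℓ)
open import Relation.Binary.Construct.Closure.ReflexiveTransitive using (Star; ε; _◅_; kleisliStar)
open import Relation.Binary.PropositionalEquality
open import Relation.Nullary using (Dec; does; yes; no; ¬_; ¬?; _×-dec_; _⊎-dec_; _→-dec_)
open import Relation.Nullary.Decidable using (dec-true)
open import Relation.Unary using (Pred; Decidable)

open Equivalence using (to; from)

-- Contractions suffice for two reasons: a complete minor never requires an edge to be deleted, and
-- in a connected graph a vertex outside all branch sets can be absorbed instead of deleted.
-- Counting vertices would force a new vertex type after each contraction. Here all graphs stay on
-- `Fin n`, the merged vertex becomes isolated, and a set `S` that holds the ends of all edges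
-- records the vertices that still count; `∣ S ∣` replaces the number of vertices throughout the
-- induction. The lifts of different cycles are different because a lift determines the cycle it
-- came from. They must also differ from the `c` triangles on `uv`, so each lift carries a proof
-- that it does not contain `u`, `v` and a common neighbour of both. All comparisons are one-sided
-- and stay in the natural numbers with every subtracted term moved across; the integers enter only
-- at the end.

private
  variable
    A B : Set
    k m n t : ℕ

-- Comparing lengths of duplicate-free lists; subsets given by predicates

unique-lookup-injective : {xs : List A} → Unique xs → Injective _≡_ _≡_ (List.lookup xs)
unique-lookup-injective (x≢ ∷ u) {zero}  {zero}  eq = refl
unique-lookup-injective (x≢ ∷ u) {zero}  {suc j} eq = ⊥-elim (All.lookup x≢ (∈-lookup j) eq)
unique-lookup-injective (x≢ ∷ u) {suc i} {zero}  eq = ⊥-elim (All.lookup x≢ (∈-lookup i) (sym eq))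
unique-lookup-injective (x≢ ∷ u) {suc i} {suc j} eq = cong suc (unique-lookup-injective u eq)

-- Positions in `ys` chosen by `total` are distinct, since each `y` is related to at most one `x`. A
-- relation is used because the lift of a cycle is only known to exist; recovering the cycle from
-- its lift is the unambiguous direction.
length-≤ : {xs : List A} {ys : List B} (R : A → B → Set) → Unique xs →
           (∀ {x x′ y} → R x y → R x′ y → x ≡ x′) →
           (∀ {x} → x List.∈ xs → ∃ λ y → y List.∈ ys × R x y) →
           length xs ℕ.≤ length ys
length-≤ {xs = xs} {ys} R u functional total = injective⇒≤ f-injective
  where
  pos : ∀ i → ∃ λ y → y List.∈ ys × R (List.lookup xs i) y
  pos i = total (∈-lookup i)

  f : Fin (length xs) → Fin (length ys)
  f i = index (proj₁ (proj₂ (pos i)))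

  R-f : ∀ i → R (List.lookup xs i) (List.lookup ys (f i))
  R-f i = subst (R _) (lookup-index (proj₁ (proj₂ (pos i)))) (proj₂ (proj₂ (pos i)))

  f-injective : Injective _≡_ _≡_ f
  f-injective {i} {j} eq = unique-lookup-injective u
    (functional (R-f i) (subst (λ l → R (List.lookup xs j) (List.lookup ys l)) (sym eq) (R-f j)))

unique-⊆⇒length-≤ : {xs ys : List A} → Unique xs → (∀ {x} → x List.∈ xs → x List.∈ ys) →
                    length xs ℕ.≤ length ys
unique-⊆⇒length-≤ u sub = length-≤ _≡_ u (λ p q → trans p (sym q)) λ x∈ → _ , sub x∈ , refl

comprehension : {P : Pred (Fin n) 0ℓ} → Decidable P → Subset n
comprehension P? = tabulate (does ∘ P?)

∈-comprehension : {P : Pred (Fin n) 0ℓ} (P? : Decidable P) (x : Fin n) →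
                  x ∈ comprehension P? ⇔ P x
∈-comprehension P? x = mk⇔ fwd bwd
  where
  fwd : _ → _
  fwd x∈ with P? x | trans (sym (Vec.lookup∘tabulate (does ∘ P?) x)) (Vec.[]=⇒lookup x∈)
  ... | yes p | _  = p
  ... | no _  | ()
  bwd : _ → _
  bwd p = Vec.lookup⇒[]= x _ (trans (Vec.lookup∘tabulate (does ∘ P?) x) (dec-true (P? x) p))

range : Vec (Fin n) k → Subset n
range vs = comprehension (λ x → any? λ i → lookup vs i ≟ x)

∈-range : (vs : Vec (Fin n) k) (x : Fin n) → x ∈ range vs ⇔ ∃ λ i → lookup vs i ≡ x
∈-range vs = ∈-comprehension (λ x → any? λ i → lookup vs i ≟ x)

subset-ext : {S T : Subset n} → (∀ x → x ∈ S ⇔ x ∈ T) → S ≡ T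
subset-ext e = ⊆-antisym (λ {x} → to (e x)) (λ {x} → from (e x))

-- Rotations of a cycle

[m+n%d]%d≡[m+n]%d : ∀ a b d .{{_ : ℕ.NonZero d}} → (a ℕ.+ b % d) % d ≡ (a ℕ.+ b) % d
[m+n%d]%d≡[m+n]%d a b d = begin
  (a ℕ.+ b % d) % d           ≡⟨ ℕ.%-distribˡ-+ a (b % d) d ⟩
  (a % d ℕ.+ b % d % d) % d   ≡⟨ cong (λ z → (a % d ℕ.+ z) % d) (ℕ.m%n%n≡m%n b d) ⟩
  (a % d ℕ.+ b % d) % d       ≡⟨ ℕ.%-distribˡ-+ a b d ⟨
  (a ℕ.+ b) % d               ∎
  where open ≡-Reasoning

-- Serves to move a prescribed vertex of a cycle to index zero. The inverse is again a rotation, by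
-- the complementary amount, so preservation of adjacency in one direction yields both.
rotate : ℕ → Fin (suc m) → Fin (suc m)
rotate {m} k i = fromℕ< (ℕ.m%n<n (k ℕ.+ toℕ i) (suc m))

toℕ-rotate : ∀ k (i : Fin (suc m)) → toℕ (rotate k i) ≡ (k ℕ.+ toℕ i) % suc m
toℕ-rotate {m} k i = toℕ-fromℕ< (ℕ.m%n<n (k ℕ.+ toℕ i) (suc m))

rotate-Next : ∀ k {i j : Fin (suc m)} → Next i j → Next (rotate k i) (rotate k j)
rotate-Next {m} k {i} {j} next = begin
  suc (toℕ (rotate k i)) % suc m           ≡⟨ cong (λ z → suc z % suc m) (toℕ-rotate k i) ⟩
  (1 ℕ.+ (k ℕ.+ toℕ i) % suc m) % suc m    ≡⟨ [m+n%d]%d≡[m+n]%d 1 (k ℕ.+ toℕ i) (suc m) ⟩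
  suc (k ℕ.+ toℕ i) % suc m                ≡⟨ cong (_% suc m) (ℕ.+-suc k (toℕ i)) ⟨
  (k ℕ.+ suc (toℕ i)) % suc m              ≡⟨ [m+n%d]%d≡[m+n]%d k (suc (toℕ i)) (suc m) ⟨
  (k ℕ.+ suc (toℕ i) % suc m) % suc m      ≡⟨ cong (λ z → (k ℕ.+ z) % suc m) next ⟩
  (k ℕ.+ toℕ j) % suc m                    ≡⟨ toℕ-rotate k j ⟨
  toℕ (rotate k j)                         ∎
  where open ≡-Reasoning

rotate-inverse : ∀ k l → k ℕ.+ l ≡ suc m → (i : Fin (suc m)) → rotate k (rotate l i) ≡ i
rotate-inverse {m} k l k+l i = toℕ-injective (begin
  toℕ (rotate k (rotate l i))               ≡⟨ toℕ-rotate k (rotate l i) ⟩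
  (k ℕ.+ toℕ (rotate l i)) % suc m          ≡⟨ cong (λ z → (k ℕ.+ z) % suc m) (toℕ-rotate l i) ⟩
  (k ℕ.+ (l ℕ.+ toℕ i) % suc m) % suc m     ≡⟨ [m+n%d]%d≡[m+n]%d k (l ℕ.+ toℕ i) (suc m) ⟩
  (k ℕ.+ (l ℕ.+ toℕ i)) % suc m             ≡⟨ cong (_% suc m) (ℕ.+-assoc k l (toℕ i)) ⟨
  (k ℕ.+ l ℕ.+ toℕ i) % suc m               ≡⟨ cong (λ z → (z ℕ.+ toℕ i) % suc m) k+l ⟩
  (suc m ℕ.+ toℕ i) % suc m                 ≡⟨ cong (_% suc m) (ℕ.+-comm (suc m) (toℕ i)) ⟩
  (toℕ i ℕ.+ suc m) % suc m                 ≡⟨ ℕ.[m+n]%n≡m%n (toℕ i) (suc m) ⟩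
  toℕ i % suc m                             ≡⟨ ℕ.m<n⇒m%n≡m (toℕ<n i) ⟩
  toℕ i                                     ∎)
  where open ≡-Reasoning

rotate-zero : (i : Fin (suc m)) → rotate (toℕ i) zero ≡ i
rotate-zero {m} i = toℕ-injective (begin
  toℕ (rotate (toℕ i) zero)   ≡⟨ toℕ-rotate (toℕ i) zero ⟩
  (toℕ i ℕ.+ 0) % suc m       ≡⟨ cong (_% suc m) (ℕ.+-identityʳ (toℕ i)) ⟩
  toℕ i % suc m               ≡⟨ ℕ.m<n⇒m%n≡m (toℕ<n i) ⟩
  toℕ i                       ∎)
  where open ≡-Reasoning

Next-rotate : (i : Fin (suc m)) → Next i (rotate 1 i)
Next-rotate i = sym (toℕ-rotate 1 i)

rotate-Adj : ∀ k {i j} → Adj (cycle m) i j → Adj (cycle m) (rotate k i) (rotate k j)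
rotate-Adj k {i} {j} = Sum.map (rotate-Next k {i} {j}) (rotate-Next k {j} {i})

-- Cycles through a given vertex

PathAdj : Fin k → Fin k → Set
PathAdj i j = suc (toℕ i) ≡ toℕ j ⊎ suc (toℕ j) ≡ toℕ i

IsEnd : Fin (suc k) → Set
IsEnd i = i ≡ zero ⊎ i ≡ fromℕ _

-- The modulus matters only when the successor wraps around to index zero, and `suc j` is not zero.
Next-suc : {i j : Fin (suc m)} → Next {suc m} (suc i) (suc j) ⇔ suc (toℕ i) ≡ toℕ j
Next-suc {m} {i} {j} = mk⇔ fwd bwd
  where
  fwd : Next {suc m} (suc i) (suc j) → suc (toℕ i) ≡ toℕ j
  fwd eq with ℕ.m≤n⇒m<n∨m≡n (toℕ<n i)
  ... | inj₁ i+1<m = ℕ.suc-injective (trans (sym (ℕ.m<n⇒m%n≡m (s≤s i+1<m))) eq)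
  ... | inj₂ i+1≡m with trans (sym eq) (trans (cong (λ z → suc z % suc (suc m)) i+1≡m) (ℕ.n%n≡0 (suc (suc m))))
  ...   | ()
  bwd : suc (toℕ i) ≡ toℕ j → Next {suc m} (suc i) (suc j)
  bwd eq = trans (ℕ.m<n⇒m%n≡m (s≤s (subst (ℕ._< suc m) (sym eq) (toℕ<n j)))) (cong suc eq)

cycle-suc-suc : {i j : Fin (2 ℕ.+ m)} → Adj (cycle m) (suc i) (suc j) ⇔ PathAdj i j
cycle-suc-suc {m} {i} {j} = mk⇔ (Sum.map (to (Next-suc {i = i})) (to (Next-suc {i = j})))
                                (Sum.map (from (Next-suc {i = i})) (from (Next-suc {i = j})))

cycle-zero-suc : {i : Fin (2 ℕ.+ m)} → Adj (cycle m) zero (suc i) ⇔ IsEnd i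
cycle-zero-suc {m} {i} = mk⇔ (Sum.map first last) (Sum.map first′ last′)
  where
  first : Next {2 ℕ.+ m} zero (suc i) → i ≡ zero
  first eq = toℕ-injective (sym (ℕ.suc-injective eq))
  first′ : i ≡ zero → Next {2 ℕ.+ m} zero (suc i)
  first′ refl = refl
  last : Next {2 ℕ.+ m} (suc i) zero → i ≡ fromℕ (suc m)
  last eq with ℕ.m≤n⇒m<n∨m≡n (toℕ<n i)
  ... | inj₁ i+1<2+m with trans (sym eq) (ℕ.m<n⇒m%n≡m (s≤s i+1<2+m))
  ...   | ()
  last eq | inj₂ i+1≡2+m =
    toℕ-injective (trans (ℕ.suc-injective i+1≡2+m) (sym (toℕ-fromℕ (suc m))))
  last′ : i ≡ fromℕ (suc m) → Next {2 ℕ.+ m} (suc i) zero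
  last′ refl = trans (cong (λ z → suc (suc z) % (3 ℕ.+ m)) (toℕ-fromℕ (suc m))) (ℕ.n%n≡0 (3 ℕ.+ m))

record IsInducedPath (G : Graph n) (ws : Vec (Fin n) k) : Set where
  field
    distinct : Injective _≡_ _≡_ (lookup ws)
    adjacent : ∀ i j → PathAdj i j ⇔ Adj G (lookup ws i) (lookup ws j)

-- A cycle seen from one of its vertices: the rest is an induced path, and `x` is adjacent to
-- exactly its ends. In this form `x` can be exchanged for one or two other vertices while the path
-- stays.
record IsPointedCycle (G : Graph n) (x : Fin n) (ws : Vec (Fin n) (suc k)) : Set where
  field
    path  : IsInducedPath G ws
    fresh : ∀ i → x ≢ lookup ws i
    ends  : ∀ i → IsEnd i ⇔ Adj G x (lookup ws i)

open IsInducedPath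
open IsPointedCycle

extend-path : (G : Graph n) {y : Fin n} {ws : Vec (Fin n) (suc k)} → IsInducedPath G ws →
              (∀ i → y ≢ lookup ws i) → (∀ i → i ≡ zero ⇔ Adj G y (lookup ws i)) →
              IsInducedPath G (y ∷ ws)
extend-path {n} {k} G {y} {ws} p y∉ws first = record { distinct = inj ; adjacent = adj }
  where
  inj : Injective _≡_ _≡_ (lookup (y ∷ ws))
  inj {zero}  {zero}  eq = refl
  inj {zero}  {suc j} eq = ⊥-elim (y∉ws j eq)
  inj {suc i} {zero}  eq = ⊥-elim (y∉ws i (sym eq))
  inj {suc i} {suc j} eq = cong suc (distinct p eq)

  start : ∀ i → PathAdj {suc (suc k)} zero (suc i) ⇔ Adj G y (lookup ws i)
  start i = mk⇔ (λ { (inj₁ eq) → to (first i) (toℕ-injective (sym (ℕ.suc-injective eq))) ; (inj₂ ()) })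
                (λ a → inj₁ (cong suc (sym (cong toℕ (from (first i) a)))))

  adj : ∀ i j → PathAdj i j ⇔ Adj G (lookup (y ∷ ws) i) (lookup (y ∷ ws) j)
  adj zero    zero    = mk⇔ (λ { (inj₁ ()) ; (inj₂ ()) }) (λ a → ⊥-elim (irrefl G refl a))
  adj zero    (suc j) = start j
  adj (suc i) zero    = mk⇔ (symm G ∘ to (start i) ∘ Sum.swap) (Sum.swap ∘ from (start i) ∘ symm G)
  adj (suc i) (suc j) =
    mk⇔ (to (adjacent p i j) ∘ Sum.map ℕ.suc-injective ℕ.suc-injective)
        (Sum.map (cong suc) (cong suc) ∘ from (adjacent p i j))

pointedCycle⇒inducesCycle : (G : Graph n) {x : Fin n} {ws : Vec (Fin n) (2 ℕ.+ m)} →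
                            IsPointedCycle G x ws → InducesCycle G (range (x ∷ ws))
pointedCycle⇒inducesCycle {m = m} G {x} {ws} c = m , x ∷ ws , inj , ∈-range (x ∷ ws) , adj
  where
  inj : Injective _≡_ _≡_ (lookup (x ∷ ws))
  inj {zero}  {zero}  eq = refl
  inj {zero}  {suc j} eq = ⊥-elim (fresh c j eq)
  inj {suc i} {zero}  eq = ⊥-elim (fresh c i (sym eq))
  inj {suc i} {suc j} eq = cong suc (distinct (path c) eq)

  start : ∀ i → Adj (cycle m) zero (suc i) ⇔ Adj G x (lookup ws i)
  start i = mk⇔ (to (ends c i) ∘ to cycle-zero-suc) (from cycle-zero-suc ∘ from (ends c i))

  adj : ∀ i j → Adj (cycle m) i j ⇔ Adj G (lookup (x ∷ ws) i) (lookup (x ∷ ws) j)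
  adj zero    zero    = mk⇔ (λ a → ⊥-elim (irrefl (cycle m) {zero} refl a)) (λ a → ⊥-elim (irrefl G refl a))
  adj zero    (suc j) = start j
  adj (suc i) zero    = mk⇔ (symm G ∘ to (start i) ∘ Sum.swap) (Sum.swap ∘ from (start i) ∘ symm G)
  adj (suc i) (suc j) = mk⇔ (to (adjacent (path c) i j) ∘ to (cycle-suc-suc {i = i}))
                            (from (cycle-suc-suc {i = i}) ∘ from (adjacent (path c) i j))

inducesCycle⇒pointedCycle : (G : Graph n) {S : Subset n} {x : Fin n} → InducesCycle G S → x ∈ S →
  ∃₂ λ m (ws : Vec (Fin n) (2 ℕ.+ m)) → IsPointedCycle G x ws × S ≡ range (x ∷ ws)
inducesCycle⇒pointedCycle {n} G {S} {x} (m , vs , inj , onto , adj) x∈S with to (onto x) x∈S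
... | k , refl = m , ws , pointed , subset-ext λ y → mk⇔ (into y) (out y)
  where
  N = 3 ℕ.+ m
  σ τ : Fin N → Fin N
  σ = rotate (toℕ k)
  τ = rotate (N ℕ.∸ toℕ k)

  σ∘τ : ∀ i → σ (τ i) ≡ i
  σ∘τ = rotate-inverse (toℕ k) (N ℕ.∸ toℕ k) (ℕ.m+[n∸m]≡n (ℕ.<⇒≤ (toℕ<n k)))
  τ∘σ : ∀ i → τ (σ i) ≡ i
  τ∘σ = rotate-inverse (N ℕ.∸ toℕ k) (toℕ k) (ℕ.m∸n+n≡m (ℕ.<⇒≤ (toℕ<n k)))

  σ-injective : Injective _≡_ _≡_ σ
  σ-injective {i} {j} eq = trans (sym (τ∘σ i)) (trans (cong τ eq) (τ∘σ j))

  ws : Vec (Fin n) (2 ℕ.+ m)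
  ws = tabulate (λ i → lookup vs (σ (suc i)))

  at : ∀ i → lookup (lookup vs k ∷ ws) i ≡ lookup vs (σ i)
  at zero    = cong (lookup vs) (sym (rotate-zero k))
  at (suc i) = Vec.lookup∘tabulate (λ i → lookup vs (σ (suc i))) i

  inj′ : Injective _≡_ _≡_ (lookup (lookup vs k ∷ ws))
  inj′ {i} {j} eq = σ-injective (inj (trans (sym (at i)) (trans eq (at j))))

  adj′ : ∀ i j → Adj (cycle m) i j ⇔ Adj G (lookup (lookup vs k ∷ ws) i) (lookup (lookup vs k ∷ ws) j)
  adj′ i j = mk⇔
    (λ a → subst₂ (Adj G) (sym (at i)) (sym (at j)) (to (adj (σ i) (σ j)) (rotate-Adj (toℕ k) {i} {j} a)))
    -- Adjacency is reflected by rotating back with the complementary rotation `τ`.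
    (λ a → subst₂ (Adj (cycle m)) (τ∘σ i) (τ∘σ j) (rotate-Adj (N ℕ.∸ toℕ k) {σ i} {σ j}
             (from (adj (σ i) (σ j)) (subst₂ (Adj G) (at i) (at j) a))))

  pointed : IsPointedCycle G (lookup vs k) ws
  pointed = record
    { path  = record
      { distinct = λ eq → suc-injective (inj′ eq)
      ; adjacent = λ i j → mk⇔ (to (adj′ (suc i) (suc j)) ∘ from (cycle-suc-suc {i = i}))
                               (to (cycle-suc-suc {i = i}) ∘ from (adj′ (suc i) (suc j)))
      }
    ; fresh = λ i eq → Fin.0≢1+n (inj′ {zero} {suc i} eq)
    ; ends  = λ i → mk⇔ (to (adj′ zero (suc i)) ∘ from cycle-zero-suc)
                        (to cycle-zero-suc ∘ from (adj′ zero (suc i)))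
    }

  into : ∀ y → y ∈ S → y ∈ range (lookup vs k ∷ ws)
  into y y∈S with to (onto y) y∈S
  ... | i , refl = from (∈-range (lookup vs k ∷ ws) y) (τ i , trans (at (τ i)) (cong (lookup vs) (σ∘τ i)))
  out : ∀ y → y ∈ range (lookup vs k ∷ ws) → y ∈ S
  out y y∈ with to (∈-range (lookup vs k ∷ ws) y) y∈
  ... | i , refl = from (onto y) (σ i , sym (at i))

singleton-path : (G : Graph n) (x : Fin n) → IsInducedPath G (x ∷ [])
singleton-path G x = record
  { distinct = λ { {zero} {zero} _ → refl }
  ; adjacent = λ { zero zero → mk⇔ (λ { (inj₁ ()) ; (inj₂ ()) }) (λ a → ⊥-elim (irrefl G refl a)) }
  }

triangle : (G : Graph n) {a b c : Fin n} → Adj G a b → Adj G b c → Adj G a c →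
           InducesCycle G (range (a ∷ b ∷ c ∷ []))
triangle G {a} {b} {c} ab bc ac = pointedCycle⇒inducesCycle G {a} {b ∷ c ∷ []} record
  { path  = extend-path G (singleton-path G c)
      (λ { zero refl → irrefl G refl bc })
      (λ { zero → mk⇔ (λ _ → bc) (λ _ → refl) })
  ; fresh = λ { zero refl → irrefl G refl ab ; (suc zero) refl → irrefl G refl ac }
  ; ends  = λ { zero → mk⇔ (λ _ → ab) (λ _ → inj₁ refl) ; (suc zero) → mk⇔ (λ _ → ac) (λ _ → inj₂ refl) }
  }

-- Keeps the isolated vertex left by a contraction out of every induced cycle.
inducesCycle⇒neighbour : (G : Graph n) {S : Subset n} {x : Fin n} → InducesCycle G S → x ∈ S → ∃ λ y → Adj G x y
inducesCycle⇒neighbour G {x = x} (m , vs , inj , onto , adj) x∈S with to (onto x) x∈S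
... | i , refl = lookup vs (rotate 1 i) , to (adj i (rotate 1 i)) (inj₁ (Next-rotate i))

-- The lists of induced cycles and of edges

∈-subsets : (S : Subset n) → S List.∈ subsets n
∈-subsets []          = here refl
∈-subsets (outside ∷ S) = ∈-++⁺ˡ (∈-map⁺ (outside ∷_) (∈-subsets S))
∈-subsets (inside ∷ S) = ∈-++⁺ʳ (List.map (outside ∷_) (subsets _)) (∈-map⁺ (inside ∷_) (∈-subsets S))

subsets-unique : ∀ n → Unique (subsets n)
subsets-unique zero    = [] ∷ []
subsets-unique (suc n) = Unique.++⁺
  (Unique.map⁺ Vec.∷-injectiveʳ (subsets-unique n))
  (Unique.map⁺ Vec.∷-injectiveʳ (subsets-unique n))
  λ (p , q) → outside≢inside (∈-map⁻ _ p) (∈-map⁻ _ q)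
  where
  outside≢inside : {S : Subset (suc n)} → (∃ λ T → T List.∈ subsets n × S ≡ outside ∷ T) →
                   ¬ (∃ λ T → T List.∈ subsets n × S ≡ inside ∷ T)
  outside≢inside (_ , _ , refl) (_ , _ , ())

∈-inducedCycles : (G : Graph n) {S : Subset n} → S List.∈ inducedCycles G ⇔ InducesCycle G S
∈-inducedCycles {n} G {S} =
  mk⇔ (proj₂ ∘ ∈-filter⁻ (inducesCycle? G) {xs = subsets n}) (∈-filter⁺ (inducesCycle? G) (∈-subsets S))

inducedCycles-unique : (G : Graph n) → Unique (inducedCycles G)
inducedCycles-unique {n} G = Unique.filter⁺ (inducesCycle? G) (subsets-unique n)

edges-unique : (G : Graph n) → Unique (edges G)
edges-unique {n} G = Unique.filter⁺ _ (Unique.cartesianProduct⁺ (Unique.allFin⁺ n) (Unique.allFin⁺ n))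

-- `edges` holds each edge only in increasing order; the sorted pair names an edge whichever end
-- comes first.
sort : Fin n → Fin n → Fin n × Fin n
sort x y with x Fin.<? y
... | yes _ = x , y
... | no _  = y , x

sort-< : {x y : Fin n} → x Fin.< y → sort x y ≡ (x , y)
sort-< {x = x} {y} x<y with x Fin.<? y
... | yes _   = refl
... | no  x≮y = ⊥-elim (x≮y x<y)

sort-comm : (x y : Fin n) → sort x y ≡ sort y x
sort-comm x y with x Fin.<? y | y Fin.<? x
... | yes x<y | yes y<x = ⊥-elim (ℕ.<-asym x<y y<x)
... | yes _   | no _    = refl
... | no _    | yes _   = refl
... | no x≮y  | no y≮x with Fin.≤-antisym (ℕ.≮⇒≥ y≮x) (ℕ.≮⇒≥ x≮y)
...   | refl = refl

sort-elim : (P : Fin n × Fin n → Set) {x y : Fin n} → P (x , y) → P (y , x) → P (sort x y)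
sort-elim P {x} {y} p q with x Fin.<? y
... | yes _ = p
... | no _  = q

∈-edges⁻ : (G : Graph n) {x y : Fin n} → (x , y) List.∈ edges G → x Fin.< y × Adj G x y
∈-edges⁻ {n} G e = proj₂ (∈-filter⁻ (λ (x , y) → (x Fin.<? y) ×-dec adj? G x y)
                                   {xs = cartesianProduct (allFin n) (allFin n)} e)

∈-edges⁺ : (G : Graph n) {x y : Fin n} → x Fin.< y → Adj G x y → (x , y) List.∈ edges G
∈-edges⁺ {n} G {x} {y} x<y a = ∈-filter⁺ (λ (x , y) → (x Fin.<? y) ×-dec adj? G x y)
  (∈-cartesianProduct⁺ (∈-allFin x) (∈-allFin y)) (x<y , a)

sort-∈-edges : (G : Graph n) {x y : Fin n} → Adj G x y → sort x y List.∈ edges G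
sort-∈-edges G {x} {y} a with x Fin.<? y
... | yes x<y = ∈-edges⁺ G x<y a
... | no  x≮y = ∈-edges⁺ G (ℕ.≤∧≢⇒< (ℕ.≮⇒≥ x≮y) λ eq → irrefl G (sym (toℕ-injective eq)) a) (symm G a)

length-edges-≤ : (G : Graph n) (es : List (Fin n × Fin n)) →
                 (∀ {x y} → Adj G x y → sort x y List.∈ es) → length (edges G) ℕ.≤ length es
length-edges-≤ G es cover = unique-⊆⇒length-≤ (edges-unique G) λ {e} e∈ →
  let x<y , a = ∈-edges⁻ G e∈ in subst (List._∈ es) (sort-< x<y) (cover a)

-- The vertex v is merged into u and remains as an isolated vertex, so that all
-- contractions of a graph share its vertex type.
contract : Graph n → Fin n → Fin n → Graph n
contract G u v = record
  { Adj    = λ x y → (x ≢ v × y ≢ v × x ≢ y) × (Adj G x y ⊎ (x ≡ u × Adj G v y) ⊎ (y ≡ u × Adj G x v))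
  ; adj?   = λ x y → (¬? (x ≟ v) ×-dec ¬? (y ≟ v) ×-dec ¬? (x ≟ y)) ×-dec
                     (adj? G x y ⊎-dec ((x ≟ u) ×-dec adj? G v y) ⊎-dec ((y ≟ u) ×-dec adj? G x v))
  ; symm   = λ ((x≢v , y≢v , x≢y) , a) → (y≢v , x≢v , x≢y ∘ sym) ,
                     [ inj₁ ∘ symm G
                     , [ (λ (p , b) → inj₂ (inj₂ (p , symm G b))) , (λ (p , b) → inj₂ (inj₁ (p , symm G b))) ]′ ]′ a
  ; irrefl = λ x≡y ((_ , _ , x≢y) , _) → x≢y x≡y
  }

-- Edges and induced cycles under contraction of an edge

module Contraction (G : Graph n) {u v : Fin n} (uv : Adj G u v) where

  G/uv : Graph n
  G/uv = contract G u v

  u≢v : u ≢ v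
  u≢v u≡v = irrefl G u≡v uv

  adj-away : {x y : Fin n} → x ≢ u → y ≢ u → x ≢ v → y ≢ v → Adj G/uv x y ⇔ Adj G x y
  adj-away x≢u y≢u x≢v y≢v = mk⇔
    (λ { (_ , inj₁ a) → a ; (_ , inj₂ (inj₁ (x≡u , _))) → ⊥-elim (x≢u x≡u)
       ; (_ , inj₂ (inj₂ (y≡u , _))) → ⊥-elim (y≢u y≡u) })
    (λ a → (x≢v , y≢v , λ x≡y → irrefl G x≡y a) , inj₁ a)

  adj-u : {x : Fin n} → u ≢ x → x ≢ v → Adj G/uv u x ⇔ (Adj G u x ⊎ Adj G v x)
  adj-u u≢x x≢v = mk⇔
    (λ { (_ , inj₁ a) → inj₁ a ; (_ , inj₂ (inj₁ (_ , a))) → inj₂ a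
       ; (_ , inj₂ (inj₂ (x≡u , _))) → ⊥-elim (u≢x (sym x≡u)) })
    (λ a → (u≢v , x≢v , u≢x) , Sum.map₂ (λ b → inj₁ (refl , b)) a)

  IsCommon : Fin n → Set
  IsCommon c = Adj G u c × Adj G v c

  isCommon? : Decidable IsCommon
  isCommon? c = adj? G u c ×-dec adj? G v c

  common : List (Fin n)
  common = filter isCommon? (allFin n)

  ∈-common : {c : Fin n} → c List.∈ common ⇔ IsCommon c
  ∈-common {c} = mk⇔ (proj₂ ∘ ∈-filter⁻ isCommon? {xs = allFin n}) (∈-filter⁺ isCommon? (∈-allFin c))

  -- An edge away from `v` survives, and an edge `vy` with `y` other than `u` and not adjacent to
  -- `u` turns into `uy`. What the contraction cannot account for is `uv` and, for each common
  -- neighbour `c`, the edge `vc`, whose image coincides with that of `uc`.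
  length-edges : length (edges G) ℕ.≤ length (edges G/uv) ℕ.+ suc (length common)
  length-edges = ℕ.≤-trans (length-edges-≤ G cover cover-all) (ℕ.≤-reflexive length-cover)
    where
    expand : Fin n → Fin n
    expand x with x ≟ u
    ... | yes _ = v
    ... | no _  = x

    -- An edge of the contraction that is absent from `G` has `u` as an end and stems from an edge
    -- at `v`.
    lift : Fin n × Fin n → Fin n × Fin n
    lift (x , y) with adj? G x y
    ... | yes _ = sort x y
    ... | no _  = sort (expand x) (expand y)

    expand-u : expand u ≡ v
    expand-u with u ≟ u
    ... | yes _  = refl
    ... | no u≢u = ⊥-elim (u≢u refl)

    expand-≢u : ∀ {x} → x ≢ u → expand x ≡ x
    expand-≢u {x} x≢u with x ≟ u
    ... | yes x≡u = ⊥-elim (x≢u x≡u)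
    ... | no _    = refl

    lift-yes : ∀ {x y} → Adj G x y → lift (x , y) ≡ sort x y
    lift-yes {x} {y} a with adj? G x y
    ... | yes _ = refl
    ... | no ¬a = ⊥-elim (¬a a)

    lift-no : ∀ {x y} → ¬ Adj G x y → lift (x , y) ≡ sort (expand x) (expand y)
    lift-no {x} {y} ¬a with adj? G x y
    ... | yes a = ⊥-elim (¬a a)
    ... | no _  = refl

    old cover : List (Fin n × Fin n)
    old   = List.map lift (edges G/uv)
    cover = old ++ sort u v ∷ List.map (sort v) common

    length-cover : length cover ≡ length (edges G/uv) ℕ.+ suc (length common)
    length-cover = trans (length-++ old)
      (cong₂ (λ a b → a ℕ.+ suc b) (length-map lift (edges G/uv)) (length-map (sort v) common))

    -- Which end of the edge comes first in the list is unknown, hence an equation for either order.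
    ∈-old : ∀ {x y e} → Adj G/uv x y → lift (x , y) ≡ e → lift (y , x) ≡ e → e List.∈ cover
    ∈-old {x} {y} {e} a eq₁ eq₂ = ∈-++⁺ˡ (subst (List._∈ old) (sort-elim (λ p → lift p ≡ e) {x} {y} eq₁ eq₂)
                                           (∈-map⁺ lift (sort-∈-edges G/uv a)))

    cover-v : ∀ {y} → Adj G v y → sort v y List.∈ cover
    cover-v {y} a with y ≟ u
    ... | yes refl = ∈-++⁺ʳ old (here (sort-comm v u))
    ... | no y≢u with adj? G u y
    ...   | yes b = ∈-++⁺ʳ old (there (∈-map⁺ (sort v) (from ∈-common (b , a))))
    -- The contraction has the edge `uy`, which is not an edge of `G`, so `lift` turns it back into
    -- `vy`.
    ...   | no ¬b = ∈-old (from (adj-u (y≢u ∘ sym) y≢v) (inj₂ a))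
                          (trans (lift-no ¬b) (cong₂ sort expand-u (expand-≢u y≢u)))
                          (trans (lift-no (¬b ∘ symm G))
                            (trans (cong₂ sort (expand-≢u y≢u) expand-u) (sort-comm y v)))
      where
      y≢v : y ≢ v
      y≢v y≡v = irrefl G (sym y≡v) a

    cover-all : ∀ {x y} → Adj G x y → sort x y List.∈ cover
    cover-all {x} {y} a with x ≟ v
    ... | yes refl = cover-v a
    ... | no x≢v with y ≟ v
    ...   | yes refl = subst (List._∈ cover) (sort-comm v x) (cover-v (symm G a))
    ...   | no y≢v   = ∈-old ((x≢v , y≢v , λ x≡y → irrefl G x≡y a) , inj₁ a)
                             (lift-yes a) (trans (lift-yes (symm G a)) (sort-comm y x))

  HasTriangle : Subset n → Set
  HasTriangle S = u ∈ S × v ∈ S × ∃ λ c → c ∈ S × IsCommon c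

  -- D is obtained from S by replacing v by u.
  Contracts : Subset n → Subset n → Set
  Contracts S D = ∀ x → x ∈ D ⇔ (x ≢ v × (x ∈ S ⊎ (x ≡ u × v ∈ S)))

  Lift : Subset n → Set
  Lift D = ∃ λ S → InducesCycle G S × ¬ HasTriangle S × Contracts S D

  v-isolated : {D : Subset n} → InducesCycle G/uv D → v ∉ D
  v-isolated c v∈D with inducesCycle⇒neighbour G/uv c v∈D
  ... | _ , (v≢v , _) , _ = v≢v refl

  -- `D` is its own lift: it avoids the isolated vertex `v`, and adjacency away from `u` and `v` is
  -- unchanged.
  lift-away : {D : Subset n} → InducesCycle G/uv D → u ∉ D → Lift D
  lift-away {D} c@(m , vs , inj , onto , adj) u∉D =
    D , (m , vs , inj , onto , adj-G) , (λ (u∈D , _) → u∉D u∈D) ,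
    λ x → mk⇔ (λ x∈D → (λ { refl → v∉D x∈D }) , inj₁ x∈D)
              (λ { (_ , inj₁ x∈D) → x∈D ; (_ , inj₂ (_ , v∈D)) → ⊥-elim (v∉D v∈D) })
    where
    v∉D = v-isolated c

    ≢-of : ∀ {w} → w ∉ D → ∀ i → lookup vs i ≢ w
    ≢-of w∉D i refl = w∉D (from (onto _) (i , refl))

    adj-G : ∀ i j → Adj (cycle m) i j ⇔ Adj G (lookup vs i) (lookup vs j)
    adj-G i j = mk⇔ (to away ∘ to (adj i j)) (from (adj i j) ∘ from away)
      where away = adj-away (≢-of u∉D i) (≢-of u∉D j) (≢-of v∉D i) (≢-of v∉D j)

  module _ {ws : Vec (Fin n) (2 ℕ.+ m)} (c : IsPointedCycle G/uv u ws) where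

    private
      D = range (u ∷ ws)
      w : Fin (2 ℕ.+ m) → Fin n
      w = lookup ws
      a b : Fin n
      a = w zero
      b = w (fromℕ (suc m))

      v∉D : v ∉ D
      v∉D = v-isolated (pointedCycle⇒inducesCycle G/uv c)

      w∈D : ∀ i → w i ∈ D
      w∈D i = from (∈-range (u ∷ ws) (w i)) (suc i , refl)

      v≢w : ∀ i → v ≢ w i
      v≢w i v≡w = v∉D (subst (_∈ D) (sym v≡w) (w∈D i))

      u≢w : ∀ i → u ≢ w i
      u≢w = fresh c

      path-G : IsInducedPath G ws
      path-G = record
        { distinct = distinct (path c)
        ; adjacent = λ i j →
            let away = adj-away (u≢w i ∘ sym) (u≢w j ∘ sym) (v≢w i ∘ sym) (v≢w j ∘ sym)
            in mk⇔ (to away ∘ to (adjacent (path c) i j)) (from (adjacent (path c) i j) ∘ from away)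
        }

      -- This rules out chords in all lifts: an inner vertex of the path is adjacent to neither `u`
      -- nor `v` in `G`.
      ends-G : ∀ i → IsEnd i ⇔ (Adj G u (w i) ⊎ Adj G v (w i))
      ends-G i = mk⇔ (to e ∘ to (ends c i)) (from (ends c i) ∘ from e)
        where e = adj-u (u≢w i) (v≢w i ∘ sym)

      contracts : ∀ {k} (vs : Vec (Fin n) k) → (∀ i → ∃ λ j → lookup vs j ≡ w i) →
                  (∀ j → lookup vs j ≡ u ⊎ lookup vs j ≡ v ⊎ ∃ λ i → lookup vs j ≡ w i) →
                  (∃ λ j → lookup vs j ≡ u ⊎ lookup vs j ≡ v) → Contracts (range vs) D
      contracts vs onto-w only hit x = mk⇔ fwd bwd
        where
        into : ∀ j {y} → lookup vs j ≡ y → y ∈ range vs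
        into j eq = from (∈-range vs _) (j , eq)

        fwd : x ∈ D → x ≢ v × (x ∈ range vs ⊎ (x ≡ u × v ∈ range vs))
        fwd x∈D with to (∈-range (u ∷ ws) x) x∈D
        ... | zero  , refl = u≢v , Sum.map (into (proj₁ hit)) (λ eq → refl , into (proj₁ hit) eq) (proj₂ hit)
        ... | suc i , refl = v≢w i ∘ sym , inj₁ (into (proj₁ (onto-w i)) (proj₂ (onto-w i)))

        bwd : x ≢ v × (x ∈ range vs ⊎ (x ≡ u × v ∈ range vs)) → x ∈ D
        bwd (x≢v , inj₂ (refl , _)) = from (∈-range (u ∷ ws) u) (zero , refl)
        bwd (x≢v , inj₁ x∈) with to (∈-range vs x) x∈
        ... | j , refl with only j
        ...   | inj₁ eq = from (∈-range (u ∷ ws) _) (zero , sym eq)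
        ...   | inj₂ (inj₁ eq) = ⊥-elim (x≢v eq)
        ...   | inj₂ (inj₂ (i , eq)) = from (∈-range (u ∷ ws) _) (suc i , sym eq)

    private
      -- The contraction treats `u` and `v` differently but the lifts do not; with `p` and `q`
      -- standing for the two in either order, each kind of lift is built once.
      Ordering : Fin n → Fin n → Set
      Ordering p q = (p ≡ u × q ≡ v) ⊎ (p ≡ v × q ≡ u)

      flip : ∀ {p q} → Ordering p q → Ordering q p
      flip (inj₁ (p≡u , q≡v)) = inj₂ (q≡v , p≡u)
      flip (inj₂ (p≡v , q≡u)) = inj₁ (q≡u , p≡v)

      adjacent-pq : ∀ {p q} → Ordering p q → Adj G p q
      adjacent-pq (inj₁ (refl , refl)) = uv
      adjacent-pq (inj₂ (refl , refl)) = symm G uv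

      fresh-p : ∀ {p q} → Ordering p q → ∀ i → p ≢ w i
      fresh-p (inj₁ (refl , _)) = u≢w
      fresh-p (inj₂ (refl , _)) = v≢w

      end-p : ∀ {p q} → Ordering p q → ∀ {i} → Adj G p (w i) → IsEnd i
      end-p (inj₁ (refl , _)) {i} pw = from (ends-G i) (inj₁ pw)
      end-p (inj₂ (refl , _)) {i} pw = from (ends-G i) (inj₂ pw)

      common-pq : ∀ {p q} → Ordering p q → ∀ {c} → IsCommon c → Adj G p c × Adj G q c
      common-pq (inj₁ (refl , refl)) (uc , vc) = uc , vc
      common-pq (inj₂ (refl , refl)) (uc , vc) = vc , uc

      member-q : ∀ {p q S} → Ordering p q → HasTriangle S → q ∈ S
      member-q (inj₁ (refl , refl)) (_ , v∈ , _) = v∈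
      member-q (inj₂ (refl , refl)) (u∈ , _) = u∈

    -- One of u and v, called p, sees both ends of the path.
    replace : ∀ {p q} → Ordering p q → Adj G p a → Adj G p b → Lift D
    replace {p} {q} pq pa pb =
      range (p ∷ ws) ,
      pointedCycle⇒inducesCycle G record { path = path-G ; fresh = fresh-p pq ; ends = ends-p } ,
      q∉ ∘ member-q pq , contracts (p ∷ ws) (λ i → suc i , refl) only (zero , p-uv)
      where
      p-uv : p ≡ u ⊎ p ≡ v
      p-uv = Sum.map proj₁ proj₁ pq
      q∉ : q ∉ range (p ∷ ws)
      q∉ q∈ with to (∈-range (p ∷ ws) q) q∈
      ... | zero  , p≡q = irrefl G p≡q (adjacent-pq pq)
      ... | suc i , eq  = fresh-p (flip pq) i (sym eq)
      ends-p : ∀ i → IsEnd i ⇔ Adj G p (w i)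
      ends-p i = mk⇔ [ (λ { refl → pa }) , (λ { refl → pb }) ]′ (end-p pq)
      only : ∀ j → lookup (p ∷ ws) j ≡ u ⊎ lookup (p ∷ ws) j ≡ v ⊎ ∃ λ i → lookup (p ∷ ws) j ≡ w i
      only zero    = Sum.map₂ inj₁ p-uv
      only (suc i) = inj₂ (inj₂ (i , refl))

    -- Each of u and v sees just one end: p the first and q the last.
    insert : ∀ {p q} → Ordering p q → Adj G p a → ¬ Adj G p b → Adj G q b → ¬ Adj G q a → Lift D
    insert {p} {q} pq pa ¬pb qb ¬qa =
      -- The new cycle is seen from `q`. Putting `p` in front of `a` extends the path, whose ends
      -- are now `p` and `b`.
      range (q ∷ p ∷ ws) ,
      pointedCycle⇒inducesCycle G record
        { path = extend-path G path-G (fresh-p pq) first-p ; fresh = fresh-q ; ends = ends-q } ,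
      no-triangle , contracts (q ∷ p ∷ ws) (λ i → suc (suc i) , refl) only (suc zero , p-uv)
      where
      p-uv : p ≡ u ⊎ p ≡ v
      p-uv = Sum.map proj₁ proj₁ pq
      qp : Adj G q p
      qp = adjacent-pq (flip pq)
      first-p : ∀ i → i ≡ zero ⇔ Adj G p (w i)
      first-p i = mk⇔ (λ { refl → pa }) λ pw →
        [ (λ eq → eq) , (λ { refl → ⊥-elim (¬pb pw) }) ]′ (end-p pq pw)
      last-q : ∀ i → i ≡ fromℕ (suc m) ⇔ Adj G q (w i)
      last-q i = mk⇔ (λ { refl → qb }) λ qw →
        [ (λ { refl → ⊥-elim (¬qa qw) }) , (λ eq → eq) ]′ (end-p (flip pq) qw)
      fresh-q : ∀ i → q ≢ lookup (p ∷ ws) i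
      fresh-q zero    eq = irrefl G eq qp
      fresh-q (suc i) eq = fresh-p (flip pq) i eq
      ends-q : ∀ i → IsEnd i ⇔ Adj G q (lookup (p ∷ ws) i)
      ends-q zero    = mk⇔ (λ _ → qp) (λ _ → inj₁ refl)
      ends-q (suc i) = mk⇔ (λ { (inj₁ ()) ; (inj₂ eq) → to (last-q i) (suc-injective eq) })
                           (inj₂ ∘ cong suc ∘ from (last-q i))
      no-triangle : ¬ HasTriangle (range (q ∷ p ∷ ws))
      -- A common neighbour on the path is adjacent to `p`, hence is `a`, which `q` does not see.
      no-triangle (_ , _ , c , c∈ , uvc) with to (∈-range (q ∷ p ∷ ws) c) c∈ | common-pq pq uvc
      ... | zero , refl        | _  , qc = irrefl G refl qc
      ... | suc zero , refl    | pc , _  = irrefl G refl pc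
      ... | suc (suc i) , refl | pc , qc with from (first-p i) pc
      ...   | refl = ¬qa qc
      only : ∀ j → lookup (q ∷ p ∷ ws) j ≡ u ⊎ lookup (q ∷ p ∷ ws) j ≡ v ⊎ ∃ λ i → lookup (q ∷ p ∷ ws) j ≡ w i
      only zero          = Sum.map proj₁ (inj₁ ∘ proj₁) (flip pq)
      only (suc zero)    = Sum.map₂ inj₁ p-uv
      only (suc (suc i)) = inj₂ (inj₂ (i , refl))

    lift-through : Lift D
    lift-through with adj? G u a | adj? G v a | adj? G u b | adj? G v b
    ... | yes ua | _      | yes ub | _      = replace (inj₁ (refl , refl)) ua ub
    ... | _      | yes va | _      | yes vb = replace (inj₂ (refl , refl)) va vb
    ... | yes ua | no ¬va | no ¬ub | yes vb = insert (inj₁ (refl , refl)) ua ¬ub vb ¬va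
    ... | no ¬ua | yes va | yes ub | no ¬vb = insert (inj₂ (refl , refl)) va ¬vb ub ¬ua
    -- In the remaining cases some end of the path is seen by neither `u` nor `v`, which contradicts
    -- `ends-G`.
    ... | no ¬ua | no ¬va | _      | _      = ⊥-elim ([ ¬ua , ¬va ]′ (to (ends-G _) (inj₁ refl)))
    ... | _      | _      | no ¬ub | no ¬vb = ⊥-elim ([ ¬ub , ¬vb ]′ (to (ends-G _) (inj₂ refl)))

  lift-cycle : {D : Subset n} → InducesCycle G/uv D → Lift D
  lift-cycle {D} c with u ∈? D
  ... | no u∉D = lift-away c u∉D
  ... | yes u∈D with inducesCycle⇒pointedCycle G/uv c u∈D
  ...   | m , ws , pointed , refl = lift-through pointed

  -- A cycle of G is charged either to the cycle of the contraction that it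
  -- lifts or, if it is a triangle through uv, to its third vertex.
  Charge : Subset n ⊎ Fin n → Subset n → Set
  Charge (inj₁ D) S = ¬ HasTriangle S × Contracts S D
  Charge (inj₂ c) S = HasTriangle S × (∀ x → (x ∈ S × IsCommon x) ⇔ x ≡ c)

  -- `Contracts` determines `D` from `S`, the third vertex is the only common neighbour in `S`, and
  -- `HasTriangle` separates the two kinds of charge.
  charge-functional : ∀ {z z′ S} → Charge z S → Charge z′ S → z ≡ z′
  charge-functional {inj₁ D} {inj₁ D′} (_ , e) (_ , e′) =
    cong inj₁ (subset-ext λ x → mk⇔ (from (e′ x) ∘ to (e x)) (from (e x) ∘ to (e′ x)))
  charge-functional {inj₁ D} {inj₂ c} (¬t , _) (t , _) = ⊥-elim (¬t t)
  charge-functional {inj₂ c} {inj₁ D} (t , _) (¬t , _) = ⊥-elim (¬t t)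
  charge-functional {inj₂ c} {inj₂ c′} (_ , e) (_ , e′) = cong inj₂ (to (e′ c) (from (e c) refl))

  charge-triangle : {c : Fin n} → IsCommon c → ∃ λ S → S List.∈ inducedCycles G × Charge (inj₂ c) S
  charge-triangle {c} (uc , vc) =
    range uvc , from (∈-inducedCycles G) (triangle G uv vc uc) ,
    (mem zero , mem (suc zero) , c , mem (suc (suc zero)) , uc , vc) ,
    λ x → mk⇔ (unique x) (λ { refl → mem (suc (suc zero)) , uc , vc })
    where
    uvc : Vec (Fin n) 3
    uvc = u ∷ v ∷ c ∷ []
    mem : ∀ i → lookup uvc i ∈ range uvc
    mem i = from (∈-range uvc _) (i , refl)
    unique : ∀ x → x ∈ range uvc × IsCommon x → x ≡ c
    unique x (x∈ , ux , vx) with to (∈-range uvc x) x∈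
    ... | zero , refl          = ⊥-elim (irrefl G refl ux)
    ... | suc zero , refl      = ⊥-elim (irrefl G refl vx)
    ... | suc (suc zero) , eq  = sym eq

  length-inducedCycles : length (inducedCycles G/uv) ℕ.+ length common ℕ.≤ length (inducedCycles G)
  length-inducedCycles = ℕ.≤-trans (ℕ.≤-reflexive (sym length-charges))
    (length-≤ Charge charges-unique (λ {z} {z′} → charge-functional {z} {z′}) charged)
    where
    old : List (Subset n ⊎ Fin n)
    old = List.map inj₁ (inducedCycles G/uv)

    charges : List (Subset n ⊎ Fin n)
    charges = old ++ List.map inj₂ common

    length-charges : length charges ≡ length (inducedCycles G/uv) ℕ.+ length common
    length-charges = trans (length-++ old)
      (cong₂ ℕ._+_ (length-map inj₁ (inducedCycles G/uv)) (length-map inj₂ common))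

    charges-unique : Unique charges
    charges-unique = Unique.++⁺
      (Unique.map⁺ inj₁-injective (inducedCycles-unique G/uv))
      (Unique.map⁺ inj₂-injective (Unique.filter⁺ isCommon? (Unique.allFin⁺ n)))
      λ (p , q) → disjoint (∈-map⁻ inj₁ p) (∈-map⁻ inj₂ q)
      where
      disjoint : ∀ {z} → (∃ λ D → D List.∈ inducedCycles G/uv × z ≡ inj₁ D) →
                 ¬ (∃ λ c → c List.∈ common × z ≡ inj₂ c)
      disjoint (_ , _ , refl) (_ , _ , ())

    charged-old : ∀ {z} → (∃ λ D → D List.∈ inducedCycles G/uv × z ≡ inj₁ D) →
                  ∃ λ S → S List.∈ inducedCycles G × Charge z S
    charged-old (D , D∈ , refl) =
      let S , cycle-S , rest = lift-cycle (to (∈-inducedCycles G/uv) D∈)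
      in S , from (∈-inducedCycles G) cycle-S , rest

    charged-common : ∀ {z} → (∃ λ c → c List.∈ common × z ≡ inj₂ c) →
                     ∃ λ S → S List.∈ inducedCycles G × Charge z S
    charged-common (c , c∈ , refl) = charge-triangle (to ∈-common c∈)

    charged : ∀ {z} → z List.∈ charges → ∃ λ S → S List.∈ inducedCycles G × Charge z S
    charged = [ charged-old ∘ ∈-map⁻ inj₁ , charged-common ∘ ∈-map⁻ inj₂ ]′ ∘ ∈-++⁻ old

  -- The inequality for `ℶ²` with subtracted terms moved across; `suc` stands for the lost vertex.
  contraction-decreases : length (inducedCycles G/uv) ℕ.+ length (edges G)
                        ℕ.≤ suc (length (inducedCycles G) ℕ.+ length (edges G/uv))
  contraction-decreases = begin
    c′ ℕ.+ length (edges G)          ≤⟨ ℕ.+-monoʳ-≤ c′ length-edges ⟩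
    c′ ℕ.+ (e′ ℕ.+ suc r)            ≡⟨ rearrange ⟩
    suc (c′ ℕ.+ r ℕ.+ e′)            ≤⟨ s≤s (ℕ.+-monoˡ-≤ e′ length-inducedCycles) ⟩
    suc (length (inducedCycles G) ℕ.+ e′) ∎
    where
    open ℕ.≤-Reasoning
    c′ = length (inducedCycles G/uv)
    e′ = length (edges G/uv)
    r  = length common
    rearrange : c′ ℕ.+ (e′ ℕ.+ suc r) ≡ suc (c′ ℕ.+ r ℕ.+ e′)
    rearrange = trans (cong (c′ ℕ.+_) (trans (ℕ.+-suc e′ r) (cong suc (ℕ.+-comm e′ r))))
                      (trans (ℕ.+-suc c′ (r ℕ.+ e′)) (cong suc (sym (ℕ.+-assoc c′ r e′))))

-- Vertex sets, walks and minor models under contraction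

x∉p∖x : (p : Subset n) (x : Fin n) → x ∉ p ∖ x
x∉p∖x (_ ∷ p) (suc x) (there x∈) = x∉p∖x p x x∈

injective⇒≤∣p∣ : (p : Subset n) (f : Fin t → Fin n) → Injective _≡_ _≡_ f → (∀ i → f i ∈ p) → t ℕ.≤ ∣ p ∣
injective⇒≤∣p∣ {t = zero}  p f f-inj f∈p = z≤n
injective⇒≤∣p∣ {t = suc t} p f f-inj f∈p = ℕ.≤-trans
  (s≤s (injective⇒≤∣p∣ (p ∖ f zero) (f ∘ suc) (suc-injective ∘ f-inj)
    λ i → x∈p∧x≢y⇒x∈p-y (f∈p (suc i)) (Fin.0≢1+n ∘ sym ∘ f-inj)))
  (x∈p⇒∣p-x∣<∣p∣ (f∈p zero))

module _ (G : Graph n) {u v : Fin n} (uv : Adj G u v) where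

  open Contraction G uv using (G/uv; u≢v)

  collapse : Fin n → Fin n
  collapse x with x ≟ v
  ... | yes _ = u
  ... | no _  = x

  collapse-≢v : ∀ {x} → x ≢ v → collapse x ≡ x
  collapse-≢v {x} x≢v with x ≟ v
  ... | yes x≡v = ⊥-elim (x≢v x≡v)
  ... | no _    = refl

  collapse-∈ : ∀ {S x} → (v ∈ S → u ∈ S) → x ∈ S → collapse x ∈ S ∖ v
  collapse-∈ {x = x} u∈ x∈S with x ≟ v
  ... | yes refl = x∈p∧x≢y⇒x∈p-y (u∈ x∈S) u≢v
  ... | no x≢v   = x∈p∧x≢y⇒x∈p-y x∈S x≢v

  collapse-adj : ∀ {x y} → Adj G x y → collapse x ≢ collapse y → Adj G/uv (collapse x) (collapse y)
  collapse-adj {x} {y} a ne with x ≟ v | y ≟ v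
  ... | yes _    | yes _    = ⊥-elim (ne refl)
  ... | yes refl | no y≢v   = (u≢v , y≢v , ne) , inj₂ (inj₁ (refl , a))
  ... | no x≢v   | yes refl = (x≢v , u≢v , ne) , inj₂ (inj₂ (refl , a))
  ... | no x≢v   | no y≢v   = (x≢v , y≢v , ne) , inj₁ a

  ∈-minus : ∀ {S x} → x ∈ S ∖ v → x ∈ S × x ≢ v
  ∈-minus {S} x∈ = p─q⊆p S ⁅ v ⁆ x∈ , λ { refl → x∉p∖x S v x∈ }

  -- The walk is mapped by `collapse` step by step, and a step whose ends coincide afterwards
  -- becomes empty. The condition that `u` accompanies `v` keeps the image inside the set.
  contract-joined : (S : Subset n) → (v ∈ S → u ∈ S) →
    (∀ x y → x ∈ S → y ∈ S → Star (InducedAdj G S) x y) →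
    ∀ x y → x ∈ S ∖ v → y ∈ S ∖ v → Star (InducedAdj G/uv (S ∖ v)) x y
  contract-joined S u∈ joined x y x∈ y∈ =
    let x∈S , x≢v = ∈-minus x∈
        y∈S , y≢v = ∈-minus y∈
    in subst₂ (Star _) (collapse-≢v x≢v) (collapse-≢v y≢v) (kleisliStar collapse step (joined x y x∈S y∈S))
    where
    step : ∀ {x y} → InducedAdj G S x y → Star (InducedAdj G/uv (S ∖ v)) (collapse x) (collapse y)
    step {x} {y} (x∈ , y∈ , a) with collapse x ≟ collapse y
    ... | yes eq = subst (Star _ _) eq ε
    ... | no ne  = (collapse-∈ u∈ x∈ , collapse-∈ u∈ y∈ , collapse-adj a ne) ◅ ε

  -- Only the branch set of `u` can lose `v`, and there `u` takes over the edges of `v`. So every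
  -- branch set stays nonempty and connected.
  contract-model : {B : Vec (Subset n) t} → IsModel (K t) G B →
    ∀ i → u ∈ lookup B i → (∀ j → v ∈ lookup B j → j ≡ i) → IsModel (K t) G/uv (Vec.map (_∖ v) B)
  contract-model {t} {B} (connected , disjoint , touching) i u∈ only-i =
    (λ j → subst (ConnectedOn G/uv) (at j)
      ((_ , collapse-∈ (u∈-if j) (proj₂ (proj₁ (connected j)))) ,
       contract-joined (lookup B j) (u∈-if j) (proj₂ (connected j)))) ,
    (λ j k j≢k x x∈ x∈′ → disjoint j k j≢k x (old j x∈) (old k x∈′)) ,
    λ j k j≢k →
      let x , y , x∈ , y∈ , a = touching j k j≢k
          x∈′ = collapse-∈ (u∈-if j) x∈
          y∈′ = collapse-∈ (u∈-if k) y∈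
      in collapse x , collapse y , subst (_ ∈_) (at j) x∈′ , subst (_ ∈_) (at k) y∈′ ,
         -- The ends remain in disjoint branch sets, so the edge joining them is not contracted.
         collapse-adj a λ eq →
           disjoint j k j≢k _ (proj₁ (∈-minus x∈′)) (subst (_∈ lookup B k) (sym eq) (proj₁ (∈-minus y∈′)))
    where
    at : ∀ j → lookup B j ∖ v ≡ lookup (Vec.map (_∖ v) B) j
    at j = sym (Vec.lookup-map j (_∖ v) B)
    old : ∀ j {x} → x ∈ lookup (Vec.map (_∖ v) B) j → x ∈ lookup B j
    old j x∈ = proj₁ (∈-minus (subst (_ ∈_) (sym (at j)) x∈))
    u∈-if : ∀ j → v ∈ lookup B j → u ∈ lookup B j
    u∈-if j v∈ with only-i j v∈
    ... | refl = u∈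

-- Complete graphs with isolated vertices

module _ (G : Graph n) (r : Fin t → Fin n) where

  length-edges-complete : (∀ {x y} → Adj G x y → ∃₂ λ i j → r i ≡ x × r j ≡ y) →
                          length (edges G) ℕ.≤ length (edges (K t))
  length-edges-complete onto = ℕ.≤-trans (length-edges-≤ G image covered)
                                         (ℕ.≤-reflexive (length-map image-of (edges (K t))))
    where
    image-of : Fin t × Fin t → Fin n × Fin n
    image-of (i , j) = sort (r i) (r j)
    image : List (Fin n × Fin n)
    image = List.map image-of (edges (K t))
    covered : ∀ {x y} → Adj G x y → sort x y List.∈ image
    covered a with onto a
    ... | i , j , refl , refl =
      subst (List._∈ image) (sort-elim (λ e → image-of e ≡ sort (r i) (r j)) {i} {j} refl (sort-comm (r j) (r i)))
            (∈-map⁺ image-of (sort-∈-edges (K t) λ i≡j → irrefl G (cong r i≡j) a))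

  length-inducedCycles-complete : Injective _≡_ _≡_ r → (∀ {i j} → i ≢ j → Adj G (r i) (r j)) →
                                  length (inducedCycles (K t)) ℕ.≤ length (inducedCycles G)
  length-inducedCycles-complete r-inj complete =
    length-≤ Image (inducedCycles-unique (K t)) functional
      (λ D∈ → image (to (∈-inducedCycles (K t)) D∈))
    where
    Image : Subset t → Subset n → Set
    Image D S = ∀ i → i ∈ D ⇔ r i ∈ S

    functional : ∀ {D D′ S} → Image D S → Image D′ S → D ≡ D′
    functional e e′ = subset-ext λ i → mk⇔ (from (e′ i) ∘ to (e i)) (from (e i) ∘ to (e′ i))

    image : ∀ {D} → InducesCycle (K t) D → ∃ λ S → S List.∈ inducedCycles G × Image D S
    image {D} (m , vs , inj , onto , adj) =
      range ws , from (∈-inducedCycles G) (m , ws , inj-ws , ∈-range ws , adj-ws) , λ i → mk⇔ (into i) (out i)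
      where
      ws : Vec (Fin n) (3 ℕ.+ m)
      ws = Vec.map r vs
      at : ∀ i → lookup ws i ≡ r (lookup vs i)
      at i = Vec.lookup-map i r vs
      inj-ws : Injective _≡_ _≡_ (lookup ws)
      inj-ws {i} {j} eq = inj (r-inj (trans (sym (at i)) (trans eq (at j))))
      adj-ws : ∀ i j → Adj (cycle m) i j ⇔ Adj G (lookup ws i) (lookup ws j)
      adj-ws i j = mk⇔
        (λ a → subst₂ (Adj G) (sym (at i)) (sym (at j)) (complete (to (adj i j) a)))
        (λ a → from (adj i j) λ eq → irrefl G (trans (at i) (trans (cong r eq) (sym (at j)))) a)
      into : ∀ i → i ∈ D → r i ∈ range ws
      into i i∈ = let j , eq = to (onto i) i∈ in from (∈-range ws (r i)) (j , trans (at j) (cong r eq))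
      out : ∀ i → r i ∈ range ws → i ∈ D
      out i ri∈ = let j , eq = to (∈-range ws (r i)) ri∈ in from (onto i) (j , r-inj (trans (sym (at j)) eq))

-- The last hypothesis sends every edge at a branch set to another branch set. A connected branch
-- set with two vertices would contain an edge, so each is a single vertex; a walk in `S` that
-- starts in a branch set stays in their union, so they exhaust `S`. Hence `G` is complete on `S`.
-- The index `suc t` provides a branch set for the walk to start from.
singletons-bound : (G : Graph n) (S : Subset n) (B : Vec (Subset n) (suc t)) →
  (∀ {x y} → Adj G x y → x ∈ S) →
  (∀ x y → x ∈ S → y ∈ S → Star (InducedAdj G S) x y) →
  (∀ i {x} → x ∈ lookup B i → x ∈ S) →
  IsModel (K (suc t)) G B →
  (∀ {x y} i → x ∈ lookup B i → Adj G x y → ∃ λ j → y ∈ lookup B j × j ≢ i) →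
  length (inducedCycles (K (suc t))) ℕ.+ length (edges G) ℕ.+ suc t
    ℕ.≤ length (inducedCycles G) ℕ.+ length (edges (K (suc t))) ℕ.+ ∣ S ∣
singletons-bound {n} {t} G S B support joined B⊆S (connected , disjoint , touching) leaves =
  ℕ.+-mono-≤ (ℕ.+-mono-≤ (length-inducedCycles-complete G r r-inj complete)
                         (length-edges-complete G r λ a → let i , eq = onto (support a)
                                                              j , eq′ = onto (support (symm G a))
                                                          in i , j , eq , eq′))
             (injective⇒≤∣p∣ S r r-inj λ i → B⊆S i (r∈ i))
  where
  r : Fin (suc t) → Fin n
  r i = proj₁ (proj₁ (connected i))
  r∈ : ∀ i → r i ∈ lookup B i
  r∈ i = proj₂ (proj₁ (connected i))

  same : ∀ {i j x} → x ∈ lookup B i → x ∈ lookup B j → i ≡ j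
  same {i} {j} x∈ x∈′ with i ≟ j
  ... | yes i≡j = i≡j
  ... | no i≢j  = ⊥-elim (disjoint i j i≢j _ x∈ x∈′)

  r-inj : Injective _≡_ _≡_ r
  r-inj {i} {j} eq = same (r∈ i) (subst (_∈ lookup B j) (sym eq) (r∈ j))

  singleton : ∀ i {x} → x ∈ lookup B i → r i ≡ x
  singleton i {x} x∈ with proj₂ (connected i) (r i) x (r∈ i) x∈
  ... | ε = refl
  ... | (y∈ , z∈ , a) ◅ _ =
    let j , z∈′ , j≢i = leaves i y∈ a in ⊥-elim (j≢i (same z∈′ z∈))

  complete : ∀ {i j} → i ≢ j → Adj G (r i) (r j)
  complete {i} {j} i≢j =
    let x , y , x∈ , y∈ , a = touching i j i≢j
    in subst₂ (Adj G) (sym (singleton i x∈)) (sym (singleton j y∈)) a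

  reach : ∀ {x y} → (∃ λ i → x ∈ lookup B i) → Star (InducedAdj G S) x y → ∃ λ j → y ∈ lookup B j
  reach i ε = i
  reach (i , x∈) ((_ , _ , a) ◅ walk) = let j , y∈ , _ = leaves i x∈ a in reach (j , y∈) walk

  onto : ∀ {x} → x ∈ S → ∃ λ i → r i ≡ x
  onto {x} x∈ =
    let j , x∈′ = reach (zero , r∈ zero) (joined (r zero) x (B⊆S zero (r∈ zero)) x∈)
    in j , singleton j x∈′

-- Induction over contractions

-- Adding the three hypotheses leaves `e′`, `c′` and `suc a′` on both sides, to be cancelled. The
-- sizes `a` and `a′` of the vertex set need only satisfy `a′ < a`, because `a` stands on the larger
-- side.
add-contraction : ∀ k t q e e′ c c′ {a a′} → c′ ℕ.+ e ℕ.≤ suc (c ℕ.+ e′) → a′ ℕ.< a →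
          k ℕ.+ e′ ℕ.+ t ℕ.≤ c′ ℕ.+ q ℕ.+ a′ → k ℕ.+ e ℕ.+ t ℕ.≤ c ℕ.+ q ℕ.+ a
add-contraction k t q e e′ c c′ {a} {a′} step a′<a ih = ℕ.+-cancelʳ-≤ (e′ ℕ.+ c′ ℕ.+ suc a′) _ _
  (subst₂ ℕ._≤_
    (solve 6 (λ k t e e′ c′ a′ → k :+ e′ :+ t :+ (c′ :+ e) :+ (con 1 :+ a′) := k :+ e :+ t :+ (e′ :+ c′ :+ (con 1 :+ a′)))
       refl k t e e′ c′ a′)
    (solve 6 (λ q c e′ c′ a a′ → c′ :+ q :+ a′ :+ (con 1 :+ (c :+ e′)) :+ a := c :+ q :+ a :+ (e′ :+ c′ :+ (con 1 :+ a′)))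
       refl q c e′ c′ a a′)
    (ℕ.+-mono-≤ (ℕ.+-mono-≤ ih step) a′<a))
  where open ℕ.+-*-Solver

-- Some neighbour outside all other branch sets can be merged into a branch
-- set until every branch set is a single vertex.
model-bound : ∀ s (G : Graph n) (S : Subset n) → ∣ S ∣ ℕ.≤ s → (B : Vec (Subset n) (suc t)) →
  (∀ {x y} → Adj G x y → x ∈ S) →
  (∀ x y → x ∈ S → y ∈ S → Star (InducedAdj G S) x y) →
  (∀ i {x} → x ∈ lookup B i → x ∈ S) →
  IsModel (K (suc t)) G B →
  length (inducedCycles (K (suc t))) ℕ.+ length (edges G) ℕ.+ suc t
    ℕ.≤ length (inducedCycles G) ℕ.+ length (edges (K (suc t))) ℕ.+ ∣ S ∣
model-bound {n} {t} s G S ∣S∣≤s B support joined B⊆S model = by-cases s ∣S∣≤s mergeable?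
  where
  -- The vertex `y` may lie in `B i` or in no branch set at all: merging it shrinks `B i` in the
  -- first case and absorbs an outside vertex in the second.
  Mergeable : Set
  Mergeable = ∃₂ λ x y → ∃ λ i → x ∈ lookup B i × Adj G x y × (∀ j → y ∈ lookup B j → j ≡ i)

  mergeable? : Dec Mergeable
  mergeable? = any? λ x → any? λ y → any? λ i →
    (x ∈? lookup B i) ×-dec adj? G x y ×-dec all? λ j → (y ∈? lookup B j) →-dec (j ≟ i)

  leaves : ¬ Mergeable → ∀ {x y} i → x ∈ lookup B i → Adj G x y → ∃ λ j → y ∈ lookup B j × j ≢ i
  leaves ¬mergeable {x} {y} i x∈ a with any? (λ j → (y ∈? lookup B j) ×-dec ¬? (j ≟ i))
  ... | yes found = found
  ... | no ¬found = ⊥-elim (¬mergeable (x , y , i , x∈ , a , only-i))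
    where
    only-i : ∀ j → y ∈ lookup B j → j ≡ i
    only-i j y∈ with j ≟ i
    ... | yes j≡i = j≡i
    ... | no j≢i  = ⊥-elim (¬found (j , y∈ , j≢i))

  by-cases : ∀ s → ∣ S ∣ ℕ.≤ s → Dec Mergeable →
    length (inducedCycles (K (suc t))) ℕ.+ length (edges G) ℕ.+ suc t
      ℕ.≤ length (inducedCycles G) ℕ.+ length (edges (K (suc t))) ℕ.+ ∣ S ∣
  by-cases s _ (no ¬mergeable) = singletons-bound G S B support joined B⊆S model (leaves ¬mergeable)
  by-cases zero ∣S∣≤0 (yes (u , v , i , u∈ , uv , only-i)) =
    -- The edge `uv` puts `v` into `S`, so `S` is not empty.
    ⊥-elim (ℕ.n≮0 (ℕ.≤-trans (x∈p⇒∣p-x∣<∣p∣ (support (symm G uv))) ∣S∣≤0))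
  by-cases (suc s) ∣S∣≤s (yes (u , v , i , u∈ , uv , only-i)) =
    add-contraction (length (inducedCycles (K (suc t)))) (suc t) (length (edges (K (suc t))))
      (length (edges G)) (length (edges G/uv)) (length (inducedCycles G)) (length (inducedCycles G/uv))
      contraction-decreases smaller
      (model-bound s G/uv (S ∖ v) (ℕ.≤-pred (ℕ.≤-trans smaller ∣S∣≤s)) (Vec.map (_∖ v) B)
        support′
        (contract-joined G uv S (λ _ → support uv) joined)
        B⊆S′
        (contract-model G uv {B = B} model i u∈ only-i))
    where
    open Contraction G uv

    smaller : ∣ S ∖ v ∣ ℕ.< ∣ S ∣
    smaller = x∈p⇒∣p-x∣<∣p∣ (support (symm G uv))

    support′ : ∀ {x y} → Adj G/uv x y → x ∈ S ∖ v
    support′ ((x≢v , _) , inj₁ a) = x∈p∧x≢y⇒x∈p-y (support a) x≢v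
    support′ ((x≢v , _) , inj₂ (inj₁ (refl , _))) = x∈p∧x≢y⇒x∈p-y (support uv) x≢v
    support′ ((x≢v , _) , inj₂ (inj₂ (_ , a))) = x∈p∧x≢y⇒x∈p-y (support a) x≢v

    B⊆S′ : ∀ j {x} → x ∈ lookup (Vec.map (_∖ v) B) j → x ∈ S ∖ v
    B⊆S′ j {x} x∈ =
      let x∈B , x≢v = ∈-minus G uv (subst (x ∈_) (Vec.lookup-map j (_∖ v) B) x∈)
      in x∈p∧x≢y⇒x∈p-y (B⊆S j x∈B) x≢v

-- Binomial coefficients and complete graphs

-- The `k`-element subsets, generated along Pascal's rule so that counting them follows the
-- recursion of `n C k`.
combinations : ∀ n → ℕ → List (Subset n)
combinations n       zero    = ⊥ ∷ []
combinations zero    (suc k) = []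
combinations (suc n) (suc k) =
  List.map (inside ∷_) (combinations n k) ++ List.map (outside ∷_) (combinations n (suc k))

length-combinations : ∀ n k → length (combinations n k) ≡ n C k
length-combinations n       zero    = refl
length-combinations zero    (suc k) = refl
length-combinations (suc n) (suc k) = begin
  length (combinations (suc n) (suc k))
    ≡⟨ length-++ (List.map (inside ∷_) (combinations n k)) ⟩
  length (List.map (inside ∷_) (combinations n k)) ℕ.+ length (List.map (outside ∷_) (combinations n (suc k)))
    ≡⟨ cong₂ ℕ._+_ (length-map (inside ∷_) (combinations n k)) (length-map (outside ∷_) (combinations n (suc k))) ⟩
  length (combinations n k) ℕ.+ length (combinations n (suc k))
    ≡⟨ cong₂ ℕ._+_ (length-combinations n k) (length-combinations n (suc k)) ⟩
  n C k ℕ.+ n C suc k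
    ≡⟨ nCk+nC[k+1]≡[n+1]C[k+1] n k ⟩
  suc n C suc k ∎
  where open ≡-Reasoning

combinations-unique : ∀ n k → Unique (combinations n k)
combinations-unique n       zero    = [] ∷ []
combinations-unique zero    (suc k) = []
combinations-unique (suc n) (suc k) = Unique.++⁺
  (Unique.map⁺ Vec.∷-injectiveʳ (combinations-unique n k))
  (Unique.map⁺ Vec.∷-injectiveʳ (combinations-unique n (suc k)))
  λ (p , q) → inside≢outside (∈-map⁻ _ p) (∈-map⁻ _ q)
  where
  inside≢outside : ∀ {S} → (∃ λ T → T List.∈ combinations n k × S ≡ inside ∷ T) →
                   ¬ (∃ λ T → T List.∈ combinations n (suc k) × S ≡ outside ∷ T)
  inside≢outside (_ , _ , refl) (_ , _ , ())

Enumeration : Subset n → Vec (Fin n) k → Set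
Enumeration S vs = Injective _≡_ _≡_ (lookup vs) × (∀ x → x ∈ S ⇔ ∃ λ i → lookup vs i ≡ x)

outside-enumeration : {S : Subset n} {vs : Vec (Fin n) k} → Enumeration S vs →
                      Enumeration (outside ∷ S) (Vec.map suc vs)
outside-enumeration {S = S} {vs} (inj , onto) =
  (λ {i} {j} eq → inj (suc-injective (trans (sym (Vec.lookup-map i suc vs)) (trans eq (Vec.lookup-map j suc vs))))) ,
  λ where
    zero    → mk⇔ (λ ()) λ (i , eq) → ⊥-elim (Fin.0≢1+n (trans (sym eq) (Vec.lookup-map i suc vs)))
    (suc x) → mk⇔
      (λ { (there x∈) → let i , eq = to (onto x) x∈ in i , trans (Vec.lookup-map i suc vs) (cong suc eq) })
      λ (i , eq) → there (from (onto x) (i , suc-injective (trans (sym (Vec.lookup-map i suc vs)) eq)))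

inside-enumeration : {S : Subset n} {vs : Vec (Fin n) k} → Enumeration S vs →
                     Enumeration (inside ∷ S) (zero ∷ Vec.map suc vs)
inside-enumeration {n = n} {k = k} {S} {vs} e = inj , onto
  where
  out = outside-enumeration {S = S} {vs} e
  inj : Injective _≡_ _≡_ (lookup (zero ∷ Vec.map suc vs))
  inj {zero}  {zero}  eq = refl
  inj {zero}  {suc j} eq = ⊥-elim (Fin.0≢1+n (trans eq (Vec.lookup-map j suc vs)))
  inj {suc i} {zero}  eq = ⊥-elim (Fin.0≢1+n (trans (sym eq) (Vec.lookup-map i suc vs)))
  inj {suc i} {suc j} eq = cong suc (proj₁ out eq)
  onto : ∀ x → x ∈ inside ∷ S ⇔ ∃ λ i → lookup (zero ∷ Vec.map suc vs) i ≡ x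
  onto zero    = mk⇔ (λ _ → zero , refl) (λ _ → here)
  onto (suc x) = mk⇔
    (λ { (there x∈) → let i , eq = to (proj₂ out (suc x)) (there x∈) in suc i , eq })
    λ { (suc i , eq) → there (back (from (proj₂ out (suc x)) (i , eq))) }
    where
    back : suc x ∈ outside ∷ S → x ∈ S
    back (there x∈) = x∈

enumerate : ∀ n k {S} → S List.∈ combinations n k → ∃ λ (vs : Vec (Fin n) k) → Enumeration S vs
enumerate n zero (here refl) = [] , (λ { {()} }) , λ x → mk⇔ (⊥-elim ∘ ∉⊥) λ ()
enumerate (suc n) (suc k) S∈ with ∈-++⁻ (List.map (inside ∷_) (combinations n k)) S∈
... | inj₁ S∈′ with ∈-map⁻ (inside ∷_) S∈′
...   | T , T∈ , refl = let vs , e = enumerate n k T∈ in zero ∷ Vec.map suc vs , inside-enumeration {vs = vs} e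
enumerate (suc n) (suc k) S∈ | inj₂ S∈′ with ∈-map⁻ (outside ∷_) S∈′
...   | T , T∈ , refl = let vs , e = enumerate n (suc k) T∈ in Vec.map suc vs , outside-enumeration {vs = vs} e

nC3≤length-inducedCycles-K : ∀ t → t C 3 ℕ.≤ length (inducedCycles (K t))
nC3≤length-inducedCycles-K t = subst (ℕ._≤ length (inducedCycles (K t))) (length-combinations t 3)
  (unique-⊆⇒length-≤ (combinations-unique t 3) λ S∈ → from (∈-inducedCycles (K t)) (cycle-on (enumerate t 3 S∈)))
  where
  cycle-on : ∀ {S} → (∃ λ (vs : Vec (Fin t) 3) → Enumeration S vs) → InducesCycle (K t) S
  cycle-on {S} (vs@(a ∷ b ∷ c ∷ []) , inj , onto) = subst (InducesCycle (K t)) (sym S≡range)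
    (triangle (K t) (λ eq → 0≢1 (inj {zero} {suc zero} eq)) (λ eq → 1≢2 (inj {suc zero} {suc (suc zero)} eq))
                    (λ eq → 0≢2 (inj {zero} {suc (suc zero)} eq)))
    where
    0≢1 : Fin.zero {2} ≢ suc zero
    0≢1 ()
    0≢2 : Fin.zero {2} ≢ suc (suc zero)
    0≢2 ()
    1≢2 : Fin.suc {2} zero ≢ suc (suc zero)
    1≢2 ()
    S≡range : S ≡ range vs
    S≡range = subset-ext λ x → mk⇔ (from (∈-range vs x) ∘ to (onto x)) (from (onto x) ∘ to (∈-range vs x))

-- Pascal's rule again: vertex zero has `t` edges, and the others form a shifted copy of the edges
-- of `K t`.
length-edges-K≤nC2 : ∀ t → length (edges (K t)) ℕ.≤ t C 2
length-edges-K≤nC2 zero    = z≤n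
length-edges-K≤nC2 (suc t) = begin
  length (edges (K (suc t)))              ≤⟨ unique-⊆⇒length-≤ (edges-unique (K (suc t))) covered ⟩
  length (from-zero ++ shifted)           ≡⟨ length-++ from-zero ⟩
  length from-zero ℕ.+ length shifted     ≡⟨ cong₂ ℕ._+_ (trans (length-map _ (allFin t)) (length-tabulate {n = t} _))
                                                         (length-map _ (edges (K t))) ⟩
  t ℕ.+ length (edges (K t))              ≤⟨ ℕ.+-mono-≤ (ℕ.≤-reflexive (sym (nC1≡n t))) (length-edges-K≤nC2 t) ⟩
  t C 1 ℕ.+ t C 2                         ≡⟨ nCk+nC[k+1]≡[n+1]C[k+1] t 1 ⟩
  suc t C 2                               ∎
  where
  open ℕ.≤-Reasoning
  from-zero shifted : List (Fin (suc t) × Fin (suc t))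
  from-zero = List.map (λ i → zero , suc i) (allFin t)
  shifted   = List.map (λ (i , j) → suc i , suc j) (edges (K t))
  covered : ∀ {e} → e List.∈ edges (K (suc t)) → e List.∈ from-zero ++ shifted
  covered {zero , zero}   e∈ = ⊥-elim (ℕ.n≮n 0 (proj₁ (∈-edges⁻ (K (suc t)) e∈)))
  covered {suc i , zero}  e∈ = ⊥-elim (ℕ.n≮0 (proj₁ (∈-edges⁻ (K (suc t)) e∈)))
  covered {zero , suc j}  e∈ = ∈-++⁺ˡ (∈-map⁺ _ (∈-allFin j))
  covered {suc i , suc j} e∈ = ∈-++⁺ʳ from-zero (∈-map⁺ _
    (let i<j , i≢j = ∈-edges⁻ (K (suc t)) e∈ in ∈-edges⁺ (K t) (ℕ.≤-pred i<j) (i≢j ∘ cong suc)))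

-- The inequality in the integers

-- Subtracting `b` and `e` from both sides of the natural-number inequality restores the alternating
-- sums.
alternating-≤ : ∀ a b c d e f → a ℕ.+ e ℕ.+ c ℕ.≤ d ℕ.+ b ℕ.+ f → + a ℤ.- + b ℤ.+ + c ℤ.≤ + d ℤ.- + e ℤ.+ + f
alternating-≤ a b c d e f le = subst₂ ℤ._≤_
  (solve 4 (λ a b c e → a :+ e :+ c :- (b :+ e) := a :- b :+ c) refl (+ a) (+ b) (+ c) (+ e))
  (solve 4 (λ b d e f → d :+ b :+ f :- (b :+ e) := d :- e :+ f) refl (+ b) (+ d) (+ e) (+ f))
  (ℤ.+-monoˡ-≤ (ℤ.- (+ b ℤ.+ + e)) (ℤ.+≤+ le))
  where open ℤ.+-*-Solver

minor-ℶ² : (G : Graph n) → Connected G → ∀ t → 1 ℕ.≤ t → IsMinor (K t) G → ℶ² (K t) ℤ.≤ ℶ² G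
minor-ℶ² {n} G (_ , joined) (suc t) _ (B , model) =
  alternating-≤ (length (inducedCycles (K (suc t)))) (length (edges (K (suc t)))) (suc t)
                (length (inducedCycles G)) (length (edges G)) n
    (subst (λ s → length (inducedCycles (K (suc t))) ℕ.+ length (edges G) ℕ.+ suc t ℕ.≤ length (inducedCycles G) ℕ.+ length (edges (K (suc t))) ℕ.+ s) (∣⊤∣≡n n)
      (model-bound n G ⊤ (ℕ.≤-reflexive (∣⊤∣≡n n)) B (λ _ → ∈⊤) joined (λ _ _ → ∈⊤) model))

-- In a connected graph the whole vertex set is the branch set of a one-vertex model, and `h G` is
-- maximal.
hadwiger-positive : (G : Graph n) → Connected G → 1 ℕ.≤ h G
hadwiger-positive G connected = proj₂ (proj₂ (hadwiger G)) 1
  (⊤ ∷ [] , (λ { zero → connected }) , (λ { zero zero i≢j → ⊥-elim (i≢j refl) }) ,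
   λ { zero zero i≢j → ⊥-elim (i≢j refl) })

binomials≤ℶ²K : ∀ t → + (t C 3) ℤ.- + (t C 2) ℤ.+ + (t C 1) ℤ.≤ ℶ² (K t)
binomials≤ℶ²K t = alternating-≤ (t C 3) (t C 2) (t C 1) (length (inducedCycles (K t))) (length (edges (K t))) t
  (ℕ.+-mono-≤ (ℕ.+-mono-≤ (nC3≤length-inducedCycles-K t) (length-edges-K≤nC2 t)) (ℕ.≤-reflexive (nC1≡n t)))

corollary3p1p1 : ∀ {n} (G : Graph n) → Connected G →
    (ℶ² (K (h G)) ≤ ℶ² G) ×
    (+ (h G C 3) - + (h G C 2) + + (h G C 1) ≤ ℶ² G)
corollary3p1p1 G connected = bound , ℤ.≤-trans (binomials≤ℶ²K (h G)) bound
  where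
  bound : ℶ² (K (h G)) ≤ ℶ² G
  bound = minor-ℶ² G connected (h G) (hadwiger-positive G connected) (proj₁ (proj₂ (hadwiger G)))
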